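{- Let $n\ge 3$ and let $G=K_{n+1}-\{e_1\}$ be the graph obtained from the complete graph $K_{n+1}$ on $\{0,1,\dots,n\}$ (root $0$) by deleting the edge $e_1=(1,n)$ joining $1$ and $n$. Then the map $\phi_G:\mathrm{sPF}(G)\longrightarrow\mathcal{U}_n'$ induced by the DFS burning algorithm is a bijection.
   Context: $\mathbb{N}=\{0,1,2,\dots\}$, $[n]=\{1,\dots,n\}$, $V=\{0,1,\dots,n\}$. Spherical parking functions: let $R=\mathbb{K}[x_1,\dots,x_n]$ over a field $\mathbb{K}$. For an undirected loopless graph $G$ on $V$ with $a_{ij}$ edges between $i$ and $j$, and $\emptyset\ne A\subseteq[n]$, put $d_A(i)=\sum_{j\in V\setminus A}a_{ij}$ and $m_A=\prod_{i\in A}x_i^{d_A(i)}$. Let $\mathcal{M}_G=\langle m_A:\emptyset\neq A\subseteq[n]\rangle$ and $\mathcal{M}_G^{(k)}=\langle m_A:\emptyset\ne A\subseteq[n],\ |A|\le k+1\rangle$ for $0\le k\le n-1$. Then $\mathrm{sPF}(G)=\{\mathcal{P}\in\mathbb{N}^n:\ \mathbf{x}^{\mathcal{P}}\in\mathcal{M}_G\setminus\mathcal{M}_G^{(n-2)}\}$; elements are viewed as functions $\mathcal{P}:[n]\to\mathbb{N}$. For $\mathcal{P}\in\mathrm{sPF}(G)$, $\mathbf{x}^{\mathcal P}$ is divisible by $m_{[n]}$, and the reduced function $\widetilde{\mathcal{P}}$ is defined by $\mathbf{x}^{\widetilde{\mathcal{P}}}=\mathbf{x}^{\mathcal{P}}/m_{[n]}$,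 i.e. $\widetilde{\mathcal{P}}(i)=\mathcal{P}(i)-a_{0i}$ (here $a_{0i}=1$ for all $i$). Uprooted trees: a rooted labelled tree on $[n]$ is uprooted if its root is larger than all children of the root. $\mathcal{U}_n'$ is the set of uprooted trees on $[n]$ in which $1$ and $n$ are not adjacent; equivalently, the uprooted spanning trees of $G-\{0\}$. DFS burning algorithm: for a simple graph $H$ with totally ordered vertices, a root $r$, and a function $\mathcal{Q}:V(H)\setminus\{r\}\to\mathbb{N}$, initially only $r$ is burnt and the set of tree edges is empty; run $\mathrm{dfs}(r)$, where $\mathrm{dfs}(i)$ is: for each neighbour $j$ of $i$ in $H$, in decreasing order, if $j$ is not burnt at that moment, then: if the current value $\mathcal{Q}(j)=0$, declare $j$ burnt, add edge $(i,j)$ to the tree edges and run $\mathrm{dfs}(j)$; otherwise (the edge is dampened) replace $\mathcal{Q}(j)$ by $\mathcal{Q}(j)-1$. If all vertices become burnt, the tree edges form a spanning tree $\phi(\mathcal{Q})$ of $H$, rooted at $r$. The map $\phi_G$: for $\mathcal{P}\in\mathrm{sPF}(G)$ let $r$ be the largest vertex in $[n]$ with $\widetilde{\mathcal{P}}(r)=0$, let $\widehat{\mathcal{P}}=\widetilde{\mathcal{P}}|_{[n]\setminus\{r\}}$, and let $\phi_G(\mathcal{P})=\phi(\widehat{\mathcal{P}})$ be the tree rooted at $r$ obtained by applying the DFS burning algorithm to $\widehat{\mathcal{P}}$ on the graph $G-\{0\}$ (on $[n]$) with root $r$. -}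

module Defs where

open import Level using (Level; _⊔_)
open import Algebra.Apartness.Bundles using (HeytingField)
open import Data.Bool using (Bool; true; false; T; not; _∧_; _∨_; if_then_else_)
open import Data.Bool.Properties using (T?; ∧-comm; ∨-comm)
open import Data.Fin using (Fin; zero; suc; toℕ) renaming (_<_ to _<ᶠ_; _≤_ to _≤ᶠ_)
open import Data.Fin.Properties using () renaming (_≟_ to _≟ᶠ_)
open import Data.Fin.Subset using (Subset; Nonempty; ∣_∣; ⁅_⁆; outside; inside) renaming (_∈_ to _∈ₛ_; ⊤ to full)
open import Data.List using (List; []; _∷_; _++_; [_]; length; foldl; filter; reverse; allFin; cartesianProductWith)
open import Data.List.Membership.Propositional using (_∈_)
open import Data.List.Relation.Unary.Linked using (Linked)
open import Data.List.Relation.Unary.Unique.Propositional using (Unique)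
open import Data.Nat using (ℕ; zero; suc; _+_; _∸_; _≤_; _≡ᵇ_) renaming (_≟_ to _≟ⁿ_)
open import Data.Product using (Σ; ∃; _×_; _,_; proj₁; proj₂)
open import Data.Sum using (_⊎_)
open import Data.Vec using (Vec; []; _∷_; lookup; tabulate; sum; zipWith; _[_]≔_)
open import Data.Vec.Properties using (≡-dec)
open import Function using (_∘_)
open import Function.Bundles using (_⇔_)
open import Relation.Binary.Bundles using (Setoid)
open import Relation.Binary.Construct.Closure.ReflexiveTransitive using (Star)
import Relation.Binary.Construct.On as On
open import Relation.Binary.PropositionalEquality using (_≡_; refl; sym; trans; cong; cong₂; setoid)
open import Relation.Nullary using (¬_; yes; no; contradiction)
open import Relation.Nullary.Decidable using (does)

private
  variable
    n : ℕ

------------------------------------------------------------------------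
-- Polynomials and ideals

-- The library's notion of field is HeytingField.  It is never trivial:
-- 1 # 0 because 1 - 0 is invertible, and # is irreflexive.
module PolynomialRing {c ℓ₁ ℓ₂ : Level} (K : HeytingField c ℓ₁ ℓ₂) (n : ℕ) where

  private module K = HeytingField K

  -- x₁^e₁ ⋯ xₙ^eₙ is represented by its exponent vector (e₁, …, eₙ).
  Exponent : Set
  Exponent = Vec ℕ n

  -- A polynomial is a formal sum of terms; repeated exponents and zero
  -- coefficients are harmless since _≈ₚ_ compares coefficients.
  Poly : Set c
  Poly = List (K.Carrier × Exponent)

  coeff : Poly → Exponent → K.Carrier
  coeff []            e = K.0#
  coeff ((a , d) ∷ p) e = (if does (≡-dec _≟ⁿ_ d e) then a else K.0#) K.+ coeff p e

  infix 4 _≈ₚ_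
  _≈ₚ_ : Poly → Poly → Set ℓ₁
  p ≈ₚ q = ∀ e → coeff p e K.≈ coeff q e

  0ₚ : Poly
  0ₚ = []

  infixl 6 _+ₚ_
  _+ₚ_ : Poly → Poly → Poly
  _+ₚ_ = _++_

  infixl 7 _*ₚ_
  _*ₚ_ : Poly → Poly → Poly
  _*ₚ_ = cartesianProductWith λ (a , d) (b , e) → a K.* b , zipWith _+_ d e

  x^_ : Exponent → Poly
  x^ e = [ K.1# , e ]

  data ⟨_⟩ {s} (S : Poly → Set s) : Poly → Set (c ⊔ ℓ₁ ⊔ s) where
    generator : ∀ {p} → S p → ⟨ S ⟩ p
    zero-mem  : ⟨ S ⟩ 0ₚ
    add-mem   : ∀ {p q} → ⟨ S ⟩ p → ⟨ S ⟩ q → ⟨ S ⟩ (p +ₚ q)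
    mul-mem   : ∀ f {p} → ⟨ S ⟩ p → ⟨ S ⟩ (f *ₚ p)
    respects  : ∀ {p q} → p ≈ₚ q → ⟨ S ⟩ p → ⟨ S ⟩ q

------------------------------------------------------------------------
-- Graphs

record SimpleGraph (N : ℕ) : Set where
  field
    adj       : Fin N → Fin N → Bool
    symmetric : ∀ i j → adj i j ≡ adj j i
    loopless  : ∀ i → adj i i ≡ false

  Adj : Fin N → Fin N → Set
  Adj i j = T (adj i j)

  multiplicity : Fin N → Fin N → ℕ
  multiplicity i j = if adj i j then 1 else 0

  Connected : Set
  Connected = ∀ i j → Star Adj i j

  -- A cycle u, v₁, …, vₖ, u with k ≥ 2 and u, v₁, …, vₖ distinct.
  IsCycle : Fin N → List (Fin N) → Set
  IsCycle u vs = 2 ≤ length vs × Unique (u ∷ vs) × Linked Adj (u ∷ vs ++ [ u ])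

  Acyclic : Set
  Acyclic = ∀ u vs → ¬ IsCycle u vs

complete : ∀ N → SimpleGraph N
complete N = record
  { adj       = λ i j → not (does (i ≟ᶠ j))
  ; symmetric = λ i j → cong not (≟-sym i j)
  ; loopless  = λ i → cong not (≟-refl i)
  }
  where
  ≟-sym : ∀ i j → does (i ≟ᶠ j) ≡ does (j ≟ᶠ i)
  ≟-sym i j with i ≟ᶠ j | j ≟ᶠ i
  ... | yes _   | yes _   = refl
  ... | no _    | no _    = refl
  ... | yes i≡j | no j≢i  = contradiction (sym i≡j) j≢i
  ... | no i≢j  | yes j≡i = contradiction (sym j≡i) i≢j

  ≟-refl : ∀ i → does (i ≟ᶠ i) ≡ true
  ≟-refl i with i ≟ᶠ i
  ... | yes _  = refl
  ... | no i≢i = contradiction refl i≢i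

-- Deletes the edge between the vertices i, j with toℕ i = u and toℕ j = v.
deleteEdge : ∀ {N} → SimpleGraph N → ℕ → ℕ → SimpleGraph N
deleteEdge H u v = record
  { adj       = λ i j → adj i j ∧ not (joins i j)
  ; symmetric = λ i j → cong₂ (λ x y → x ∧ not y) (symmetric i j) (joins-sym i j)
  ; loopless  = λ i → cong (_∧ not (joins i i)) (loopless i)
  }
  where
  open SimpleGraph H

  joins : _ → _ → Bool
  joins i j = (toℕ i ≡ᵇ u) ∧ (toℕ j ≡ᵇ v) ∨ (toℕ i ≡ᵇ v) ∧ (toℕ j ≡ᵇ u)

  joins-sym : ∀ i j → joins i j ≡ joins j i
  joins-sym i j = trans
    (∨-comm ((toℕ i ≡ᵇ u) ∧ (toℕ j ≡ᵇ v)) ((toℕ i ≡ᵇ v) ∧ (toℕ j ≡ᵇ u)))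
    (cong₂ _∨_ (∧-comm (toℕ i ≡ᵇ v) (toℕ j ≡ᵇ u)) (∧-comm (toℕ i ≡ᵇ u) (toℕ j ≡ᵇ v)))

-- G - {0}.  From here on V = {0, …, n} is Fin (suc n) with vertex k being
-- the element of value k, and [n] is Fin n, included in V by suc; so
-- i : Fin n carries the label toℕ (suc i).
removeRoot : SimpleGraph (suc n) → SimpleGraph n
removeRoot H = record
  { adj       = λ i j → adj (suc i) (suc j)
  ; symmetric = λ i j → symmetric (suc i) (suc j)
  ; loopless  = λ i → loopless (suc i)
  }
  where open SimpleGraph H

label : Fin n → ℕ
label i = toℕ (suc i)

K-e₁ : ∀ n → SimpleGraph (suc n)
K-e₁ n = deleteEdge (complete (suc n)) 1 n

------------------------------------------------------------------------
-- Spherical parking functions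

outdegree : (Fin (suc n) → Fin (suc n) → ℕ) → Subset n → Fin n → ℕ
outdegree a A i = sum (tabulate λ j → if lookup (outside ∷ A) j then 0 else a (suc i) j)

-- The exponent vector of m_A.
m-exponent : (Fin (suc n) → Fin (suc n) → ℕ) → Subset n → Vec ℕ n
m-exponent a A = tabulate λ i → if lookup A i then outdegree a A i else 0

module _ {c ℓ₁ ℓ₂ : Level} (K : HeytingField c ℓ₁ ℓ₂) {n : ℕ} (G : SimpleGraph (suc n)) where

  open PolynomialRing K n
  open SimpleGraph G using (multiplicity)

  𝓜 : Poly → Set (c ⊔ ℓ₁)
  𝓜 = ⟨ (λ p → ∃ λ A → Nonempty A × p ≡ x^ m-exponent multiplicity A) ⟩

  𝓜^ : ℕ → Poly → Set (c ⊔ ℓ₁)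
  𝓜^ k = ⟨ (λ p → ∃ λ A → Nonempty A × ∣ A ∣ ≤ suc k × p ≡ x^ m-exponent multiplicity A) ⟩

  IsSPF : Vec ℕ n → Set (c ⊔ ℓ₁)
  IsSPF P = 𝓜 (x^ P) × ¬ 𝓜^ (n ∸ 2) (x^ P)

  sPF : Setoid (c ⊔ ℓ₁) _
  sPF = On.setoid {B = Σ (Vec ℕ n) IsSPF} (setoid (Vec ℕ n)) proj₁

------------------------------------------------------------------------
-- Uprooted trees

record RootedTree (n : ℕ) : Set where
  field
    graph     : SimpleGraph n
    root      : Fin n
    connected : SimpleGraph.Connected graph
    acyclic   : SimpleGraph.Acyclic graph
  open SimpleGraph graph public

rootedTrees : ℕ → Setoid _ _
rootedTrees n = record
  { Carrier       = RootedTree n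
  ; _≈_           = λ t t′ → root t ≡ root t′ × (∀ i j → adj t i j ≡ adj t′ i j)
  ; isEquivalence = record
    { refl  = refl , λ _ _ → refl
    ; sym   = λ (r , e) → sym r , λ i j → sym (e i j)
    ; trans = λ (r , e) (r′ , e′) → trans r r′ , λ i j → trans (e i j) (e′ i j)
    }
  }
  where open RootedTree

-- The children of the root are exactly its neighbours.
Uprooted : RootedTree n → Set
Uprooted t = ∀ j → Adj root j → j <ᶠ root
  where open RootedTree t

IsU′ : RootedTree n → Set
IsU′ {n} t = Uprooted t × (∀ i j → label i ≡ 1 → label j ≡ n → ¬ RootedTree.Adj t i j)

U′ : ℕ → Setoid _ _
U′ n = On.setoid {B = Σ (RootedTree n) IsU′} (rootedTrees n) proj₁

------------------------------------------------------------------------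
-- The DFS burning algorithm

record State (n : ℕ) : Set where
  constructor state
  field
    burnt : Subset n
    value : Vec ℕ n
    edges : List (Fin n × Fin n)

module DFS (H : SimpleGraph n) where

  open SimpleGraph H using (adj)
  open State

  neighbours↓ : Fin n → List (Fin n)
  neighbours↓ i = filter (T? ∘ adj i) (reverse (allFin n))

  -- The first argument is fuel.  Every nested call burns a new vertex, so
  -- the recursion depth is at most the number of vertices; started with
  -- fuel n from a single burnt vertex, dfs never runs out of fuel.
  mutual
    dfs : ℕ → Fin n → State n → State n
    dfs zero       i s = s
    dfs (suc fuel) i s = foldl (visit fuel i) s (neighbours↓ i)

    visit : ℕ → Fin n → State n → Fin n → State n
    visit fuel i s j with lookup (burnt s) j | lookup (value s) j
    ... | true  | _     = s
    ... | false | zero  = dfs fuel j (state (burnt s [ j ]≔ inside) (value s) ((i , j) ∷ edges s))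
    ... | false | suc q = state (burnt s) (value s [ j ]≔ q) (edges s)

  -- 𝒬 is only used away from r: the entry at r is never read, since r is
  -- burnt from the start.
  burn : Fin n → Vec ℕ n → State n
  burn r 𝒬 = dfs n r (state ⁅ r ⁆ 𝒬 [])

-- φ_G(P) = t.  Every component of t that matters for equality of rooted
-- trees is determined by P.
record φ[_]_↦_ (G : SimpleGraph (suc n)) (P : Vec ℕ n) (t : RootedTree n) : Set where
  open SimpleGraph G using (multiplicity)
  open RootedTree t using (root; Adj)
  open DFS (removeRoot G) using (burn)
  open State
  field
    reduced      : Vec ℕ n
    reduced-def  : zipWith _+_ reduced (m-exponent multiplicity full) ≡ P
    root-zero    : lookup reduced root ≡ 0
    root-largest : ∀ j → lookup reduced j ≡ 0 → j ≤ᶠ root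
    all-burnt    : ∀ j → j ∈ₛ burnt (burn root reduced)
    tree-edges   : ∀ i j → Adj i j ⇔
                   ((i , j) ∈ edges (burn root reduced) ⊎ (j , i) ∈ edges (burn root reduced))

{-# OPTIONS --safe #-}

-- Let H = G - {0}, and write P = Q + (1, …, 1).  Membership of a monomial in a monomial ideal is divisibility by a
-- generator, so P is spherical iff every nonempty proper A ⊂ [n] has an i ∈ A with Q(i) < #(neighbours of i outside A).
--
-- Burning.  Run the algorithm from r.  A vertex x left unburnt has been dampened by each burnt neighbour, so Q(x) is
-- at least the number of its burnt neighbours; hence everything burns if Q satisfies the condition for all A ∌ r.
-- Conversely, if everything burns, the first vertex of A to burn witnesses the condition for A ∌ r.  The run can be
-- replayed from the tree t alone (burn j from i iff ij is an edge of t), and then Q is recovered backwards from its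
-- final values, which are all 0; this gives both injectivity and surjectivity onto the spanning trees rooted at r.
--
-- The root.  The root visits its larger neighbours before anything else is burnt, so they are all dampened iff their
-- values are positive: the tree is uprooted iff no neighbour j > r has Q(j) = 0.  The root of an uprooted tree is not 1,
-- so it is adjacent to every larger vertex.  It remains to check the condition for an uprooted tree and A ∋ r.  Since
-- Q(r) = 0, this is clear if r has a neighbour outside A; otherwise r = n and A = [n] ∖ {1}, and the first child c of
-- the root has Q(c) = 0 and is adjacent to 1.
module Submission where

open import Level using (Level; 0ℓ)
open import Algebra.Apartness.Bundles using (HeytingField)
import Algebra.Apartness.Properties.HeytingCommutativeRing as HeytingProperties
open import Data.Bool using (true; false; T; if_then_else_; not; _∧_; _∨_)
open import Data.Bool.Properties using (T?; T-∧; T-∨; T-≡; ∧-zeroʳ; ∨-comm) renaming (_≟_ to _≟ᵇ_)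
open import Data.Empty using (⊥)
open import Data.Fin using (Fin; zero; suc; toℕ; fromℕ<) renaming (_<_ to _<ᶠ_; _≤_ to _≤ᶠ_)
open import Data.Fin.Properties using (toℕ-injective; toℕ<n) renaming (_≟_ to _≟ᶠ_)
import Data.Fin.Properties as Fin
open import Data.Fin.Subset using (Subset; Nonempty; ∣_∣; ⁅_⁆; ∁; inside) renaming (_∈_ to _∈ₛ_; ⊤ to full; ⊥ to empty)
open import Data.Fin.Subset.Properties using (∣p∣≡n⇒p≡⊤; ∣p∣≤n; ∈⊤; p⊂q⇒∣p∣<∣q∣; ⊆⊤; ∣⊤∣≡n; x∈⁅x⁆; x∈⁅y⁆⇒x≡y; ∣∁p∣≡n∸∣p∣; ∣⁅x⁆∣≡1)
open import Data.List using (List; []; _∷_; _++_; [_]; map; length; foldl; reverse; allFin)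
open import Data.List.Properties using (unfold-reverse)
open import Data.List.Membership.Propositional using (_∈_; _∉_)
open import Data.List.Membership.Propositional.Properties using (∈-filter⁺; ∈-allFin)
open import Data.List.Relation.Unary.All using (All; []; _∷_) renaming (lookup to All-lookup; map to mapᴬ; tabulate to tabulateᴬ)
import Data.List.Relation.Unary.All.Properties as All
open import Data.List.Relation.Unary.AllPairs using (AllPairs; []; _∷_)
import Data.List.Relation.Unary.AllPairs as AllPairs
import Data.List.Relation.Unary.AllPairs.Properties as AllPairs
open import Data.List.Relation.Unary.Any using (here; there; any?)
import Data.List.Relation.Unary.Any.Properties as Any
open import Data.List.Relation.Unary.Linked using (Linked; [-]; _∷_)
import Data.List.Relation.Unary.Linked as Linked
open import Data.List.Relation.Unary.Unique.Propositional using (Unique)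
open import Data.Nat using (ℕ; zero; suc; _+_; _∸_; _≤_; _<_; z≤n; s≤s; _<?_; _≡ᵇ_)
import Data.Nat.Properties as ℕ
open import Data.Nat.Tactic.RingSolver using (solve-∀)
open import Data.Product using (Σ; ∃; ∃₂; _×_; _,_; proj₁; proj₂)
open import Data.Product.Properties using () renaming (≡-dec to ×-≡-dec)
open import Data.Sum using (_⊎_; inj₁; inj₂; swap)
open import Data.Unit using (⊤; tt)
open import Data.Vec using (Vec; []; _∷_; lookup; tabulate; sum; zipWith; replicate; _[_]≔_)
open import Data.Vec.Properties using (≡-dec; lookup-zipWith; lookup∘tabulate; tabulate∘lookup; tabulate-cong; lookup⇒[]=; []=⇒lookup; lookup∘update; lookup∘update′; []≔-idempotent; []≔-lookup; lookup-map; lookup-replicate; zipWith-assoc; zipWith-comm; zipWith-identityˡ)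
open import Function using (_∘_; flip)
open import Function.Bundles using (_⇔_; mk⇔; Equivalence; Bijection)
open import Relation.Binary using (Rel; DecidableEquality; tri<; tri≈; tri>)
open import Relation.Binary.Bundles using (Setoid)
open import Relation.Binary.Construct.Closure.ReflexiveTransitive using (Star; ε; _◅_; _◅◅_)
import Relation.Binary.Construct.Closure.ReflexiveTransitive as Star
open import Relation.Binary.PropositionalEquality using (_≡_; _≢_; refl; sym; trans; cong; cong₂; subst; subst₂; ≢-sym)
open import Relation.Nullary using (¬_; Dec; yes; no; does; contradiction)
open import Relation.Nullary.Decidable using (_×-dec_; _⊎-dec_; decidable-stable)
open import Relation.Unary using (Decidable)
open import Defs

private
  variable
    n : ℕ

lookup-ext : ∀ {a} {A : Set a} (u v : Vec A n) → (∀ i → lookup u i ≡ lookup v i) → u ≡ v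
lookup-ext u v eq = trans (sym (tabulate∘lookup u)) (trans (tabulate-cong eq) (tabulate∘lookup v))

-- Monomial ideals

infixl 6 _⊕_
_⊕_ : Vec ℕ n → Vec ℕ n → Vec ℕ n
_⊕_ = zipWith _+_

⊕-cancelˡ : ∀ (d : Vec ℕ n) {e f} → d ⊕ e ≡ d ⊕ f → e ≡ f
⊕-cancelˡ d {e} {f} eq = lookup-ext e f λ i → ℕ.+-cancelˡ-≡ (lookup d i) _ _
  (trans (sym (lookup-zipWith _+_ i d e)) (trans (cong (λ v → lookup v i) eq) (lookup-zipWith _+_ i d f)))

infix 4 _∣ᵉ_
_∣ᵉ_ : Vec ℕ n → Vec ℕ n → Set
m ∣ᵉ e = ∃ λ q → q ⊕ m ≡ e

≤⇒∣ᵉ : ∀ {m e : Vec ℕ n} → (∀ i → lookup m i ≤ lookup e i) → m ∣ᵉ e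
≤⇒∣ᵉ {m = m} {e} m≤e = zipWith _∸_ e m , lookup-ext _ _ λ i →
  trans (lookup-zipWith _+_ i (zipWith _∸_ e m) m)
        (trans (cong (_+ lookup m i) (lookup-zipWith _∸_ i e m)) (ℕ.m∸n+n≡m (m≤e i)))

∣ᵉ⇒≤ : ∀ {m e : Vec ℕ n} → m ∣ᵉ e → ∀ i → lookup m i ≤ lookup e i
∣ᵉ⇒≤ {m = m} (q , refl) i = subst (lookup m i ≤_) (sym (lookup-zipWith _+_ i q m)) (ℕ.m≤n+m (lookup m i) (lookup q i))

∣ᵉ-dec : ∀ (m e : Vec ℕ n) → Dec (m ∣ᵉ e)
∣ᵉ-dec m e with Fin.any? (λ i → lookup e i <? lookup m i)
... | yes (i , e<m) = no λ m∣e → ℕ.<⇒≱ e<m (∣ᵉ⇒≤ m∣e i)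
... | no e≮m        = yes (≤⇒∣ᵉ λ i → ℕ.≮⇒≥ λ e<m → e≮m (i , e<m))

module MonomialIdeal {c ℓ₁ ℓ₂ : Level} (K : HeytingField c ℓ₁ ℓ₂) (n : ℕ) where

  open PolynomialRing K n
  private module K = HeytingField K

  coeff-++ : ∀ p q e → coeff (p ++ q) e K.≈ coeff p e K.+ coeff q e
  coeff-++ []      q e = K.sym (K.+-identityˡ _)
  coeff-++ (t ∷ p) q e = K.trans (K.+-congˡ (coeff-++ p q e)) (K.sym (K.+-assoc _ _ _))

  term* : K.Carrier × Exponent → Poly → Poly
  term* (a , d) = map λ (b , e) → a K.* b , d ⊕ e

  -- Translation by `d` is injective on exponents, so the terms of the product that land on `d ⊕ e`
  -- are exactly the images of the terms of `p` at `e`.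
  coeff-term*-∣ : ∀ a d p e → coeff (term* (a , d) p) (d ⊕ e) K.≈ a K.* coeff p e
  coeff-term*-∣ a d []            e = K.sym (K.zeroʳ a)
  coeff-term*-∣ a d ((b , f) ∷ p) e = K.trans (K.+-cong head (coeff-term*-∣ a d p e)) (K.sym (K.distribˡ a _ _))
    where
    head : (if does (≡-dec ℕ._≟_ (d ⊕ f) (d ⊕ e)) then a K.* b else K.0#)
           K.≈ a K.* (if does (≡-dec ℕ._≟_ f e) then b else K.0#)
    head with ≡-dec ℕ._≟_ (d ⊕ f) (d ⊕ e) | ≡-dec ℕ._≟_ f e
    ... | yes _  | yes _   = K.refl
    ... | no _   | no _    = K.sym (K.zeroʳ a)
    ... | yes eq | no f≢e  = contradiction (⊕-cancelˡ d eq) f≢e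
    ... | no neq | yes f≡e = contradiction (cong (d ⊕_) f≡e) neq

  coeff-term*-∤ : ∀ a d p e → ¬ d ∣ᵉ e → coeff (term* (a , d) p) e K.≈ K.0#
  coeff-term*-∤ a d []            e d∤e = K.refl
  coeff-term*-∤ a d ((b , f) ∷ p) e d∤e with ≡-dec ℕ._≟_ (d ⊕ f) e
  ... | yes eq = contradiction (f , trans (zipWith-comm ℕ.+-comm f d) eq) d∤e
  ... | no _   = K.trans (K.+-identityˡ _) (coeff-term*-∤ a d p e d∤e)

  -- `Gen` lists generators as polynomials and `S` lists their exponents; keeping both lets `𝓜` and
  -- `𝓜^` be treated as two instances of one argument.
  module _ {g s} {Gen : Poly → Set g} {S : Exponent → Set s}
           (gen⇒S : ∀ {p} → Gen p → ∃ λ m → S m × p ≡ x^ m)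
           (S⇒gen : ∀ {m} → S m → Gen (x^ m)) where

    Multiple : Exponent → Set s
    Multiple e = ∃ λ m → S m × m ∣ᵉ e

    -- Induction on membership. In a product, a term with exponent `d` reaches `e` only if `e` is
    -- `d ⊕ q`; then `q` is no multiple either, because a generator dividing `q` would divide `e`.
    coeff-nonmultiple : ∀ {p} → ⟨ Gen ⟩ p → ∀ e → ¬ Multiple e → coeff p e K.≈ K.0#
    coeff-nonmultiple (generator Gp) e ∤e with gen⇒S Gp
    ... | m , Sm , refl with ≡-dec ℕ._≟_ m e
    ...   | yes refl = contradiction (m , Sm , replicate n 0 , zipWith-identityˡ ℕ.+-identityˡ m) ∤e
    ...   | no _     = K.+-identityˡ _
    coeff-nonmultiple zero-mem e ∤e = K.refl
    coeff-nonmultiple (add-mem {p} {q} Ip Iq) e ∤e =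
      K.trans (coeff-++ p q e)
        (K.trans (K.+-cong (coeff-nonmultiple Ip e ∤e) (coeff-nonmultiple Iq e ∤e)) (K.+-identityˡ _))
    coeff-nonmultiple (mul-mem f {p} Ip) e ∤e = go f
      where
      go : ∀ f → coeff (f *ₚ p) e K.≈ K.0#
      go []            = K.refl
      go ((a , d) ∷ f) = K.trans (coeff-++ (term* (a , d) p) (f *ₚ p) e)
                           (K.trans (K.+-cong head (go f)) (K.+-identityˡ _))
        where
        head : coeff (term* (a , d) p) e K.≈ K.0#
        head with ∣ᵉ-dec d e
        ... | no d∤e        = coeff-term*-∤ a d p e d∤e
        ... | yes (q , eq) with refl ← trans (zipWith-comm ℕ.+-comm d q) eq =
          K.trans (coeff-term*-∣ a d p q)
            (K.trans (K.*-congˡ (coeff-nonmultiple Ip q λ (m , Sm , r , r⊕m≡q) →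
              ∤e (m , Sm , d ⊕ r , trans (zipWith-assoc ℕ.+-assoc d r m) (cong (d ⊕_) r⊕m≡q)))) (K.zeroʳ a))
    coeff-nonmultiple (respects p≈q Ip) e ∤e = K.trans (K.sym (p≈q e)) (coeff-nonmultiple Ip e ∤e)

    -- Only doubly negated: divisibility by some element of S need not be decidable.
    monomial-mem⇒multiple : ∀ {e} → ⟨ Gen ⟩ (x^ e) → ¬ ¬ Multiple e
    monomial-mem⇒multiple {e} Ie ∤e with coeff-nonmultiple Ie e ∤e
    ... | eq with ≡-dec ℕ._≟_ e e
    -- The coefficient of `x^ e` at `e` is 1 + 0; its vanishing would contradict 1 # 0.
    ...   | yes _  = K.#-irrefl (K.trans (K.sym (K.+-identityʳ _)) eq) (HeytingProperties.1#0 K.heytingCommutativeRing)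
    ...   | no e≢e = e≢e refl

    multiple⇒monomial-mem : ∀ {e} → Multiple e → ⟨ Gen ⟩ (x^ e)
    multiple⇒monomial-mem (m , Sm , q , refl) = respects 1·1≈1 (mul-mem (x^ q) (generator (S⇒gen Sm)))
      where
      1·1≈1 : (x^ q *ₚ x^ m) ≈ₚ (x^ (q ⊕ m))
      1·1≈1 e with ≡-dec ℕ._≟_ (q ⊕ m) e
      ... | yes _ = K.+-congʳ (K.*-identityˡ _)
      ... | no _  = K.refl

-- Spherical parking functions as a condition on subsets

weight : Subset n → (Fin n → ℕ) → ℕ
weight B f = sum (tabulate λ j → if lookup B j then f j else 0)

-- For `f = multiplicity x`, `weight B f` is the number of neighbours of `x` in `B`, and
-- `coweight A f` the number outside `A`. The latter has the shape of `outdegree` with its summand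
-- at vertex 0 removed.
coweight : Subset n → (Fin n → ℕ) → ℕ
coweight A f = sum (tabulate λ j → if lookup A j then 0 else f j)

coweight-full : ∀ {n} (f : Fin n → ℕ) → coweight full f ≡ 0
coweight-full {zero}  f = refl
coweight-full {suc n} f = coweight-full (f ∘ suc)

-- Q is the reduced function of a spherical parking function: x^(Q + m_[n]) is divisible by m_A for no proper A.
Parking : SimpleGraph n → Vec ℕ n → Set
Parking H Q = ∀ A x y → lookup A x ≡ true → lookup A y ≡ false →
  ∃ λ i → lookup A i ≡ true × lookup Q i < coweight A (SimpleGraph.multiplicity H i)

module Spherical {c ℓ₁ ℓ₂ : Level} (K : HeytingField c ℓ₁ ℓ₂) {n : ℕ} (G : SimpleGraph (suc n))
                 (cone : ∀ i → SimpleGraph.multiplicity G (suc i) zero ≡ 1) (n≥2 : 2 ≤ n) where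

  open PolynomialRing K n
  open MonomialIdeal K n
  open SimpleGraph G using (multiplicity)

  H : SimpleGraph n
  H = removeRoot G

  m : Subset n → Vec ℕ n
  m = m-exponent multiplicity

  -- Vertex 0 lies outside every `A`, and by `cone` it adds 1 to each out-degree. This 1 is the
  -- shift by `m full` between P and its reduced function.
  lookup-m : ∀ A {i} → lookup A i ≡ true → lookup (m A) i ≡ suc (coweight A (SimpleGraph.multiplicity H i))
  lookup-m A {i} Ai = trans (lookup∘tabulate _ i)
    (trans (cong (λ b → if b then outdegree multiplicity A i else 0) Ai) (cong (_+ coweight A (SimpleGraph.multiplicity H i)) (cone i)))

  lookup-m∉ : ∀ A {i} → lookup A i ≡ false → lookup (m A) i ≡ 0
  lookup-m∉ A {i} Ai = trans (lookup∘tabulate _ i) (cong (λ b → if b then outdegree multiplicity A i else 0) Ai)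

  lookup-m-full : ∀ i → lookup (m full) i ≡ 1
  lookup-m-full i = trans (lookup-m full ([]=⇒lookup (∈⊤ {x = i}))) (cong suc (coweight-full (SimpleGraph.multiplicity H i)))

  private
    -- The size bound in `𝓜^ (n ∸ 2)` is `suc (n ∸ 2)`, which is n - 1 since n ≥ 2: its generators
    -- belong to the nonempty proper subsets.
    n∸1 : suc (suc (n ∸ 2)) ≡ n
    n∸1 = ℕ.m+[n∸m]≡n n≥2

  proper⇒small : ∀ (A : Subset n) y → lookup A y ≡ false → ∣ A ∣ ≤ suc (n ∸ 2)
  proper⇒small A y Ay = ℕ.≤-pred (subst (∣ A ∣ <_) {∣ full {n} ∣} (trans (∣⊤∣≡n n) (sym n∸1)) (p⊂q⇒∣p∣<∣q∣ {p = A} {full} (⊆⊤ , y , ∈⊤ , y∉A)))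
    where
    y∉A : ¬ y ∈ₛ A
    y∉A y∈A with () ← trans (sym Ay) ([]=⇒lookup y∈A)

  small⇒proper : ∀ (A : Subset n) → ∣ A ∣ ≤ suc (n ∸ 2) → ∃ λ y → lookup A y ≡ false
  small⇒proper A ∣A∣≤ with Fin.any? (λ y → lookup A y ≟ᵇ false)
  ... | yes y = y
  ... | no ¬y = contradiction (subst (λ B → ∣ B ∣ ≤ suc (n ∸ 2)) A≡full ∣A∣≤)
                  (ℕ.<⇒≱ {suc (n ∸ 2)} {∣ full {n} ∣} (ℕ.≤-reflexive (trans n∸1 (sym (∣⊤∣≡n n)))))
    where
    all : ∀ i → lookup A i ≡ lookup full i
    all i with lookup A i in eq
    ... | true  = sym ([]=⇒lookup (∈⊤ {x = i}))
    ... | false = contradiction (i , eq) ¬y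

    A≡full : A ≡ full
    A≡full = lookup-ext A full all

  exceeds : ∀ {P} A → ¬ m A ∣ᵉ P → ∃ λ i → lookup A i ≡ true × lookup P i < lookup (m A) i
  exceeds {P} A ∤P with Fin.any? (λ i → lookup A i ≟ᵇ true ×-dec lookup P i <? lookup (m A) i)
  ... | yes found = found
  ... | no none   = contradiction (≤⇒∣ᵉ bounded) ∤P
    where
    bounded : ∀ i → lookup (m A) i ≤ lookup P i
    bounded i with lookup A i in Ai
    ... | false = subst (_≤ lookup P i) (sym (lookup-m∉ A Ai)) z≤n
    ... | true  = ℕ.≮⇒≥ λ P<m → none (i , Ai , P<m)

  private
    S S′ : Exponent → Set
    S e  = ∃ λ A → Nonempty A × e ≡ m A
    S′ e = ∃ λ A → Nonempty A × ∣ A ∣ ≤ suc (n ∸ 2) × e ≡ m A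

    gen⇒S : ∀ {p} → (∃ λ A → Nonempty A × p ≡ x^ m A) → ∃ λ e → S e × p ≡ x^ e
    gen⇒S (A , ne , eq) = m A , (A , ne , refl) , eq

    S⇒gen : ∀ {e} → S e → ∃ λ A → Nonempty A × x^ e ≡ x^ m A
    S⇒gen (A , ne , eq) = A , ne , cong x^_ eq

    gen⇒S′ : ∀ {p} → (∃ λ A → Nonempty A × ∣ A ∣ ≤ suc (n ∸ 2) × p ≡ x^ m A) → ∃ λ e → S′ e × p ≡ x^ e
    gen⇒S′ (A , ne , small , eq) = m A , (A , ne , small , refl) , eq

    S⇒gen′ : ∀ {e} → S′ e → ∃ λ A → Nonempty A × ∣ A ∣ ≤ suc (n ∸ 2) × x^ e ≡ x^ m A
    S⇒gen′ (A , ne , small , eq) = A , ne , small , cong x^_ eq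

  spf⇒parking : ∀ {P} → IsSPF K G P → ∃ λ Q → Q ⊕ m full ≡ P × Parking H Q
  spf⇒parking {P} (P∈M , P∉M′) = proj₁ full∣P , proj₂ full∣P , parking (proj₁ full∣P) (proj₂ full∣P)
    where
    small∤P : ∀ A → Nonempty A → ∣ A ∣ ≤ suc (n ∸ 2) → ¬ m A ∣ᵉ P
    small∤P A ne small m∣P = P∉M′ (multiple⇒monomial-mem gen⇒S′ S⇒gen′ (m A , (A , ne , small , refl) , m∣P))

    full∣P : m full ∣ᵉ P
    -- Divisibility by the single monomial `m full` is decidable, so the double negation can be
    -- removed here. The generator dividing P cannot come from a small set, hence comes from `full`.
    full∣P = decidable-stable (∣ᵉ-dec _ P) λ full∤P → monomial-mem⇒multiple gen⇒S S⇒gen P∈M λ where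
      (_ , (A , ne , refl) , m∣P) → small∤P A ne
        (ℕ.≤-pred (subst (∣ A ∣ <_) (sym n∸1) (ℕ.≤∧≢⇒< (∣p∣≤n A) λ ∣A∣≡n →
          full∤P (subst (λ B → m B ∣ᵉ P) (∣p∣≡n⇒p≡⊤ {p = A} ∣A∣≡n) m∣P)))) m∣P

    parking : ∀ Q → Q ⊕ m full ≡ P → Parking H Q
    parking Q refl A x y Ax Ay with exceeds A (small∤P A (x , lookup⇒[]= x A Ax) (proper⇒small A y Ay))
    ... | i , Ai , P<m = i , Ai , ℕ.≤-pred (subst (_≤ suc (coweight A (SimpleGraph.multiplicity H i))) (cong suc P≡)
                                            (subst (suc (lookup P i) ≤_) (lookup-m A Ai) P<m))
      where
      P≡ : lookup (Q ⊕ m full) i ≡ suc (lookup Q i)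
      P≡ = trans (lookup-zipWith _+_ i Q (m full)) (trans (cong (lookup Q i +_) (lookup-m-full i)) (ℕ.+-comm _ 1))

  parking⇒spf : ∀ {Q} → Parking H Q → IsSPF K G (Q ⊕ m full)
  parking⇒spf {Q} park = multiple⇒monomial-mem gen⇒S S⇒gen (m full , (full , (x₀ , ∈⊤) , refl) , Q , refl)
                       , λ P∈M′ → monomial-mem⇒multiple gen⇒S′ S⇒gen′ P∈M′ indivisible
    where
    x₀ : Fin n
    x₀ = subst Fin n∸1 zero

    indivisible : ¬ ∃ λ e → S′ e × e ∣ᵉ (Q ⊕ m full)
    indivisible (_ , (A , (x , x∈A) , small , refl) , m∣P)
      with y , Ay ← small⇒proper A small
      with i , Ai , Q< ← park A x y ([]=⇒lookup x∈A) Ay =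
      ℕ.<⇒≱ (subst (_ <_) (sym (lookup-m A Ai)) (s≤s Q<))
        (subst (lookup (m A) i ≤_)
          (trans (lookup-zipWith _+_ i Q (m full)) (trans (cong (lookup Q i +_) (lookup-m-full i)) (ℕ.+-comm _ 1)))
          (∣ᵉ⇒≤ m∣P i))

-- Cycles, paths and trees

module Cycles {A : Set} {R : Rel A 0ℓ} (R-sym : ∀ {x y} → R x y → R y x) where

  Cycle : A → List A → Set
  Cycle u vs = 2 ≤ length vs × Unique (u ∷ vs) × Linked R (u ∷ vs ++ [ u ])

  TwoNeighbours : A → Set
  TwoNeighbours x = ∃₂ λ a b → a ≢ b × R x a × R x b

  -- The walk around a cycle starts with `p` and `q` both equal to its base point, where length at
  -- least 2 keeps the neighbours of the first inner vertex distinct. From then on the predecessor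
  -- `p` is an inner vertex, so `p ≢ q` takes over.
  inner-neighbours : ∀ p xs {q x} → Linked R (p ∷ xs ++ [ q ]) → Unique (p ∷ xs) → All (_≢ q) xs →
                     2 ≤ length xs ⊎ p ≢ q → x ∈ xs → TwoNeighbours x
  inner-neighbours p (y ∷ [])     (l ∷ l′ ∷ _) _ _ (inj₁ (s≤s ())) (here refl)
  inner-neighbours p (y ∷ [])     (l ∷ l′ ∷ _) _ _ (inj₂ p≢q) (here refl) = _ , _ , p≢q , R-sym l , l′
  inner-neighbours p (y ∷ z ∷ ys) (l ∷ l′ ∷ _) ((_ ∷ p≢z ∷ _) ∷ _) _ _ (here refl) = _ , _ , p≢z , R-sym l , l′
  inner-neighbours p (y ∷ ys)     (_ ∷ ls) (_ ∷ uniq) (y≢q ∷ ≢q) _ (there x∈) =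
    inner-neighbours y ys ls uniq ≢q (inj₂ y≢q) x∈

  last-neighbour : ∀ p x xs {q} → Linked R (p ∷ (x ∷ xs) ++ [ q ]) → ∃ λ a → a ∈ x ∷ xs × R a q
  last-neighbour p x []       (_ ∷ l ∷ _) = x , here refl , l
  last-neighbour p x (y ∷ xs) (_ ∷ ls) with last-neighbour x y xs ls
  ... | a , a∈ , l = a , there a∈ , l

  cycle-neighbours : ∀ u vs {x} → Cycle u vs → x ∈ u ∷ vs → TwoNeighbours x
  cycle-neighbours u (v ∷ w ∷ ws) (_ , _ ∷ (v≢ ∷ _) , l ∷ ls) (here refl) with last-neighbour v w ws ls
  ... | a , a∈ , l′ = v , a , All-lookup v≢ a∈ , l , R-sym l′
  cycle-neighbours u (_ ∷ []) (s≤s () , _) (here refl)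
  cycle-neighbours u vs (2≤ , uniq@(u≢ ∷ _) , ls) (there x∈) =
    inner-neighbours u vs ls uniq (mapᴬ ≢-sym u≢) (inj₁ 2≤) x∈

data Path {A : Set} (R : Rel A 0ℓ) : A → A → List A → Set where
  []  : ∀ {x} → Path R x x []
  _∷_ : ∀ {x y z vs} → R x y → Path R y z vs → Path R x z (y ∷ vs)

module _ {A : Set} {R : Rel A 0ℓ} where

  suffix : ∀ {x y z vs} → Path R y z vs → Unique (y ∷ vs) → x ∈ y ∷ vs → ∃ λ ws → Path R x z ws × Unique (x ∷ ws)
  suffix p       uniq       (here refl) = _ , p , uniq
  suffix (_ ∷ p) (_ ∷ uniq) (there x∈)  = suffix p uniq x∈

  -- Loop erasure: if `x` already lies on the simple path from its successor, the path is cut down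
  -- to the part starting at `x`.
  simple-path : DecidableEquality A → ∀ {x z} → Star R x z → ∃ λ vs → Path R x z vs × Unique (x ∷ vs)
  simple-path _≟_ ε = [] , [] , [] ∷ []
  simple-path _≟_ {x} (_◅_ {j = y} Rxy ys) with simple-path _≟_ ys
  ... | vs , p , uniq with any? (x ≟_) (y ∷ vs)
  ...   | yes x∈ = suffix p uniq x∈
  ...   | no x∉  = y ∷ vs , Rxy ∷ p , All.¬Any⇒All¬ (y ∷ vs) x∉ ∷ uniq

  path-linked : ∀ {x z w vs} {S : Rel A 0ℓ} → (∀ {a b} → R a b → S a b) → Path R x z vs → S z w → Linked S (x ∷ vs ++ [ w ])
  path-linked R⇒S []      l = l ∷ [-]
  path-linked R⇒S (r ∷ p) l = R⇒S r ∷ path-linked R⇒S p l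

-- An edge outside R would close a cycle with the simple R-path between its ends.
module _ {n} (t : SimpleGraph n) {R : Rel (Fin n) 0ℓ} where

  open SimpleGraph t

  spanning-subgraph : Acyclic → (∀ {a b} → R a b → Adj a b) → (∀ a b → Star R a b) →
                      (∀ a b → Dec (R a b)) → ∀ {a b} → Adj a b → R a b
  spanning-subgraph acyclic R⇒Adj conn R? {a} {b} ab with R? a b
  ... | yes Rab = Rab
  ... | no ¬Rab with simple-path _≟ᶠ_ (conn a b)
  ...   | [] , [] , _ = contradiction ab (subst (λ c → ¬ T c) (sym (loopless a)) λ ())
  ...   | _ ∷ [] , (Rab ∷ []) , _ = contradiction Rab ¬Rab
  ...   | vs@(_ ∷ _ ∷ _) , p , uniq = contradiction
    (s≤s (s≤s z≤n) , uniq , path-linked R⇒Adj p (subst T (symmetric a b) ab)) (acyclic a vs)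

-- Trees grown by attaching leaves

Edges : ℕ → Set
Edges n = List (Fin n × Fin n)

Joined : Edges n → Fin n → Fin n → Set
Joined E i j = (i , j) ∈ E ⊎ (j , i) ∈ E

edge? : ∀ (e : Fin n × Fin n) E → Dec (e ∈ E)
edge? e = any? (×-≡-dec _≟ᶠ_ _≟ᶠ_ e)

⁅⁆-true : ∀ (r : Fin n) → lookup ⁅ r ⁆ r ≡ true
⁅⁆-true r = []=⇒lookup (x∈⁅x⁆ r)

⁅⁆-≡ : ∀ (r x : Fin n) → lookup ⁅ r ⁆ x ≡ true → x ≡ r
⁅⁆-≡ r x eq = x∈⁅y⁆⇒x≡y r (lookup⇒[]= x ⁅ r ⁆ eq)

t≢f : ∀ {b} → b ≡ true → b ≡ false → ⊥
t≢f refl ()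

insert-mono : ∀ (B : Subset n) j x → lookup B x ≡ true → lookup (B [ j ]≔ inside) x ≡ true
insert-mono B j x Bx with x ≟ᶠ j
... | yes refl = lookup∘update j B inside
... | no x≢j   = trans (lookup∘update′ x≢j B inside) Bx

insert-inv : ∀ (B : Subset n) j x → lookup (B [ j ]≔ inside) x ≡ true → x ≡ j ⊎ lookup B x ≡ true
insert-inv B j x Bx with x ≟ᶠ j
... | yes x≡j = inj₁ x≡j
... | no x≢j  = inj₂ (trans (sym (lookup∘update′ x≢j B inside)) Bx)

module Growth (H : SimpleGraph n) (r : Fin n) where

  open SimpleGraph H

  -- The history of the algorithm with values and order of visits forgotten. The head of the edge
  -- list leads to the vertex burnt last, so the tree properties follow by removing leaves one at a
  -- time.
  data Grown : Subset n → Edges n → Set where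
    start : Grown ⁅ r ⁆ []
    grow  : ∀ {B E i j} → lookup B i ≡ true → lookup B j ≡ false → Adj i j →
            Grown B E → Grown (B [ j ]≔ inside) ((i , j) ∷ E)

  grown-endpoints : ∀ {B E a b} → Grown B E → (a , b) ∈ E → lookup B a ≡ true × lookup B b ≡ true
  grown-endpoints (grow {B} {j = j} Bi Bj _ g) (here refl) = insert-mono B j _ Bi , lookup∘update j B inside
  grown-endpoints (grow {B} {j = j} Bi Bj _ g) (there e∈) with grown-endpoints g e∈
  ... | Ba , Bb = insert-mono B j _ Ba , insert-mono B j _ Bb

  grown-adj : ∀ {B E a b} → Grown B E → (a , b) ∈ E → Adj a b
  grown-adj (grow _ _ ij _) (here refl) = ij
  grown-adj (grow _ _ _ g)  (there e∈)  = grown-adj g e∈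

  joined-weaken : ∀ {E e} {a b : Fin n} → Joined E a b → Joined (e ∷ E) a b
  joined-weaken (inj₁ e∈) = inj₁ (there e∈)
  joined-weaken (inj₂ e∈) = inj₂ (there e∈)

  grown-reach : ∀ {B E} → Grown B E → ∀ x → lookup B x ≡ true → Star (Joined E) x r
  grown-reach start x Bx with refl ← ⁅⁆-≡ r x Bx = ε
  grown-reach (grow {B} {E} {i} {j} Bi Bj _ g) x Bx with insert-inv B j x Bx
  ... | inj₁ refl = inj₂ (here refl) ◅ Star.map joined-weaken (grown-reach g i Bi)
  ... | inj₂ Bx′  = Star.map joined-weaken (grown-reach g x Bx′)

  -- Every older edge has both ends in `B`, which `j` has not yet joined.
  leaf : ∀ {B E i j a} → Grown B E → lookup B j ≡ false → lookup B i ≡ true → Joined ((i , j) ∷ E) j a → a ≡ i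
  leaf g Bj Bi (inj₁ (here refl)) = contradiction Bj (t≢f Bi)
  leaf g Bj Bi (inj₂ (here refl)) = refl
  leaf g Bj Bi (inj₁ (there e∈))  = contradiction Bj (t≢f (proj₁ (grown-endpoints g e∈)))
  leaf g Bj Bi (inj₂ (there e∈))  = contradiction Bj (t≢f (proj₂ (grown-endpoints g e∈)))

  joined-strengthen : ∀ {E} {i j a b : Fin n} → j ≢ a → j ≢ b → Joined ((i , j) ∷ E) a b → Joined E a b
  joined-strengthen j≢a j≢b (inj₁ (here refl)) = contradiction refl j≢b
  joined-strengthen j≢a j≢b (inj₂ (here refl)) = contradiction refl j≢a
  joined-strengthen j≢a j≢b (inj₁ (there e∈))  = inj₁ e∈
  joined-strengthen j≢a j≢b (inj₂ (there e∈))  = inj₂ e∈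

  linked-strengthen : ∀ {E} {i j : Fin n} {vs} → All (j ≢_) vs → Linked (Joined ((i , j) ∷ E)) vs → Linked (Joined E) vs
  linked-strengthen _                   Linked.[] = Linked.[]
  linked-strengthen _                   [-]       = [-]
  linked-strengthen (j≢a ∷ ≢s@(j≢b ∷ _)) (l ∷ ls) = joined-strengthen j≢a j≢b l ∷ linked-strengthen ≢s ls

  -- The vertex burnt last is a leaf, hence lies on no cycle.
  grown-acyclic : ∀ {B E} → Grown B E → ∀ u vs → ¬ Cycles.Cycle {R = Joined E} swap u vs
  grown-acyclic start u (v ∷ _) (_ , _ , inj₁ () ∷ _)
  grown-acyclic start u (v ∷ _) (_ , _ , inj₂ () ∷ _)
  grown-acyclic (grow {E = E} {i} {j} Bi Bj _ g) u vs cycle@(2≤ , uniq , ls) with any? (j ≟ᶠ_) (u ∷ vs)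
  ... | yes j∈ with Cycles.cycle-neighbours {R = Joined ((i , j) ∷ E)} swap u vs cycle j∈
  ...   | a , b , a≢b , ja , jb = a≢b (trans (leaf g Bj Bi ja) (sym (leaf g Bj Bi jb)))
  grown-acyclic (grow {E = E} {i} {j} Bi Bj _ g) u vs cycle@(2≤ , uniq , ls)
      | no j∉ with All.¬Any⇒All¬ (u ∷ vs) j∉
  ...   | j≢u ∷ j≢vs = grown-acyclic g u vs (2≤ , uniq , linked-strengthen (j≢u ∷ All.++⁺ j≢vs (j≢u ∷ [])) ls)

  joinedGraph : ∀ {B E} → Grown B E → SimpleGraph n
  joinedGraph {E = E} g = record
    { adj       = λ i j → does (edge? (i , j) E) ∨ does (edge? (j , i) E)
    ; symmetric = λ i j → ∨-comm (does (edge? (i , j) E)) _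
    ; loopless  = loopless′
    }
    where
    loopless′ : ∀ i → does (edge? (i , i) E) ∨ does (edge? (i , i) E) ≡ false
    loopless′ i with edge? (i , i) E
    ... | yes e∈ = contradiction (grown-adj g e∈) (subst (λ c → ¬ T c) (sym (loopless i)) λ ())
    ... | no _   = refl

  joinedGraph-adj : ∀ {B E} (g : Grown B E) i j → SimpleGraph.Adj (joinedGraph g) i j ⇔ Joined E i j
  joinedGraph-adj {E = E} g i j = mk⇔ to from
    where
    to : T (does (edge? (i , j) E) ∨ does (edge? (j , i) E)) → Joined E i j
    to with edge? (i , j) E | edge? (j , i) E
    ... | yes e∈ | _      = λ _ → inj₁ e∈
    ... | no _   | yes e∈ = λ _ → inj₂ e∈
    ... | no _   | no _   = λ ()
    from : Joined E i j → T (does (edge? (i , j) E) ∨ does (edge? (j , i) E))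
    from with edge? (i , j) E | edge? (j , i) E
    ... | yes e∈ | _      = λ _ → _
    ... | no _   | yes e∈ = λ _ → _
    ... | no ∉   | no ∉′  = λ { (inj₁ e∈) → ∉ e∈ ; (inj₂ e∈) → ∉′ e∈ }

  grown-connected : ∀ {B E} → Grown B E → (∀ x → lookup B x ≡ true) → ∀ a b → Star (Joined E) a b
  grown-connected g all a b = grown-reach g a (all a) ◅◅ Star.reverse swap (grown-reach g b (all b))

  spanningTree : ∀ {B E} → Grown B E → (∀ x → lookup B x ≡ true) → RootedTree n
  spanningTree g all = record
    { graph     = joinedGraph g
    ; root      = r
    ; connected = λ a b → Star.map (Equivalence.from (joinedGraph-adj g _ _)) (grown-connected g all a b)
    ; acyclic   = λ u vs (2≤ , uniq , ls) →
                    grown-acyclic g u vs (2≤ , uniq , Linked.map (λ {a} {b} → Equivalence.to (joinedGraph-adj g a b)) ls)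
    }

-- Runs of the burning algorithm

weight-empty : ∀ {n} (f : Fin n → ℕ) → weight empty f ≡ 0
weight-empty {zero}  f = refl
weight-empty {suc n} f = weight-empty (f ∘ suc)

weight-insert : ∀ (B : Subset n) j f → lookup B j ≡ false → weight (B [ j ]≔ inside) f ≡ f j + weight B f
weight-insert (false ∷ B) zero    f refl = refl
weight-insert (b ∷ B)     (suc j) f Bj   =
  trans (cong (b₀ +_) (weight-insert B j (f ∘ suc) Bj)) (x+[y+z] b₀ (f (suc j)) (weight B (f ∘ suc)))
  where
  b₀ : ℕ
  b₀ = if b then f zero else 0
  x+[y+z] : ∀ x y z → x + (y + z) ≡ y + (x + z)
  x+[y+z] = solve-∀

weight-⁅⁆ : ∀ (r : Fin n) f → weight ⁅ r ⁆ f ≡ f r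
weight-⁅⁆ zero    f = trans (cong (f zero +_) (weight-empty (f ∘ suc))) (ℕ.+-identityʳ _)
weight-⁅⁆ (suc r) f = weight-⁅⁆ r (f ∘ suc)

weight-mono : ∀ (B C : Subset n) f → (∀ x → lookup B x ≡ true → lookup C x ≡ true) → weight B f ≤ weight C f
weight-mono []          []      f B⊆C = z≤n
weight-mono (false ∷ B) (c ∷ C) f B⊆C = ℕ.≤-trans (weight-mono B C (f ∘ suc) (B⊆C ∘ suc)) (ℕ.m≤n+m _ _)
weight-mono (true ∷ B)  (c ∷ C) f B⊆C with refl ← B⊆C zero refl =
  ℕ.+-monoʳ-≤ (f zero) (weight-mono B C (f ∘ suc) (B⊆C ∘ suc))

weight-∁ : ∀ (A : Subset n) f → weight (∁ A) f ≡ coweight A f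
weight-∁ []          f = refl
weight-∁ (true ∷ A)  f = weight-∁ A (f ∘ suc)
weight-∁ (false ∷ A) f = cong (f zero +_) (weight-∁ A (f ∘ suc))

coweight-∁ : ∀ (B : Subset n) f → coweight (∁ B) f ≡ weight B f
coweight-∁ []          f = refl
coweight-∁ (true ∷ B)  f = cong (f zero +_) (coweight-∁ B (f ∘ suc))
coweight-∁ (false ∷ B) f = coweight-∁ B (f ∘ suc)

coweight-≥ : ∀ (A : Subset n) y f → lookup A y ≡ false → f y ≤ coweight A f
coweight-≥ (false ∷ A) zero    f refl = ℕ.m≤m+n (f zero) _
coweight-≥ (b ∷ A)     (suc y) f Ay   = ℕ.≤-trans (coweight-≥ A y (f ∘ suc) Ay) (ℕ.m≤n+m _ _)

lookup-∁ : ∀ (A : Subset n) x → lookup (∁ A) x ≡ not (lookup A x)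
lookup-∁ A x = lookup-map x not A

-- The measure compared with the fuel: burning a vertex lowers it by one, and no visit raises it.
unburnt : Subset n → ℕ
unburnt B = ∣ ∁ B ∣

unburnt-insert : ∀ (B : Subset n) j → lookup B j ≡ false → unburnt B ≡ suc (unburnt (B [ j ]≔ inside))
unburnt-insert (false ∷ B) zero    refl = refl
unburnt-insert (true ∷ B)  (suc j) Bj   = unburnt-insert B j Bj
unburnt-insert (false ∷ B) (suc j) Bj   = cong suc (unburnt-insert B j Bj)

unburnt-mono : ∀ (B C : Subset n) → (∀ x → lookup B x ≡ true → lookup C x ≡ true) → unburnt C ≤ unburnt B
unburnt-mono []          []          B⊆C = z≤n
unburnt-mono (true ∷ B)  (c ∷ C)     B⊆C with refl ← B⊆C zero refl = unburnt-mono B C (B⊆C ∘ suc)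
unburnt-mono (false ∷ B) (true ∷ C)  B⊆C = ℕ.m≤n⇒m≤1+n (unburnt-mono B C (B⊆C ∘ suc))
unburnt-mono (false ∷ B) (false ∷ C) B⊆C = s≤s (unburnt-mono B C (B⊆C ∘ suc))

indicator : Fin n → Fin n → ℕ
indicator x j = if does (x ≟ᶠ j) then 1 else 0

indicator-≡ : ∀ (x : Fin n) → indicator x x ≡ 1
indicator-≡ x with x ≟ᶠ x
... | yes _  = refl
... | no x≢x = contradiction refl x≢x

indicator-≢ : ∀ {x j : Fin n} → x ≢ j → indicator x j ≡ 0
indicator-≢ {x = x} {j} x≢j with x ≟ᶠ j
... | yes x≡j = contradiction x≡j x≢j
... | no _    = refl

-- For a list of pending visits, the number of times `x` will still be visited from the current
-- vertex.
occurrences : Fin n → List (Fin n) → ℕ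
occurrences x []       = 0
occurrences x (j ∷ js) = indicator x j + occurrences x js

occurrences-∉ : ∀ (x : Fin n) js → x ∉ js → occurrences x js ≡ 0
occurrences-∉ x []       x∉ = refl
occurrences-∉ x (j ∷ js) x∉ =
  cong₂ _+_ (indicator-≢ (λ x≡j → x∉ (here x≡j))) (occurrences-∉ x js (x∉ ∘ there))

occurrences-∈ : ∀ (x : Fin n) js → Unique js → x ∈ js → occurrences x js ≡ 1
occurrences-∈ x (j ∷ js) (j≢ ∷ _)    (here refl) =
  cong₂ _+_ (indicator-≡ x) (occurrences-∉ x js λ x∈ → All-lookup j≢ x∈ refl)
occurrences-∈ x (j ∷ js) (j≢ ∷ uniq) (there x∈)  =
  cong₂ _+_ (indicator-≢ (λ x≡j → All-lookup j≢ x∈ (sym x≡j))) (occurrences-∈ x js uniq x∈)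

AllPairs-reverse : ∀ {A : Set} {R : Rel A 0ℓ} {xs} → AllPairs R xs → AllPairs (flip R) (reverse xs)
AllPairs-reverse []                            = []
AllPairs-reverse {R = R} (_∷_ {x} {xs} Rx Rxs) = subst (AllPairs (flip R)) (sym (unfold-reverse x xs))
  (AllPairs.++⁺ (AllPairs-reverse Rxs) ([] ∷ []) (tabulateᴬ λ y∈ → All-lookup Rx (Any.reverse⁻ y∈) ∷ []))

antimono : ∀ {b c} → (b ≡ true → c ≡ true) → c ≡ false → b ≡ false
antimono {false} b⇒c c≡f = refl
antimono {true}  b⇒c c≡f = contradiction c≡f (t≢f (b⇒c refl))

insert-false : ∀ (B : Subset n) j x → lookup (B [ j ]≔ inside) x ≡ false → lookup B x ≡ false
insert-false B j x = antimono (insert-mono B j x)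

-- Big-step runs and the edges they add

module Burning (H : SimpleGraph n) where

  open SimpleGraph H
  open DFS H
  open State

  ignite : Fin n → Fin n → State n → State n
  ignite i j s = state (burnt s [ j ]≔ inside) (value s) ((i , j) ∷ edges s)

  dampen : Fin n → ℕ → State n → State n
  dampen j q s = state (burnt s) (value s [ j ]≔ q) (edges s)

  -- Big-step semantics of the visits from i to the vertices of a list; a visit that burns j requires Y i j,
  -- one that dampens the edge requires N i j.
  data Run (Y N : Rel (Fin n) 0ℓ) : Fin n → List (Fin n) → State n → State n → Set where
    done  : ∀ {i s} → Run Y N i [] s s
    skip  : ∀ {i j js s s′} → lookup (burnt s) j ≡ true →
            Run Y N i js s s′ → Run Y N i (j ∷ js) s s′
    burns : ∀ {i j js s s₁ s₂} → lookup (burnt s) j ≡ false → lookup (value s) j ≡ 0 → Y i j →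
            Run Y N j (neighbours↓ j) (ignite i j s) s₁ → Run Y N i js s₁ s₂ → Run Y N i (j ∷ js) s s₂
    damps : ∀ {i j js q s s′} → lookup (burnt s) j ≡ false → lookup (value s) j ≡ suc q → N i j →
            Run Y N i js (dampen j q s) s′ → Run Y N i (j ∷ js) s s′

  Always : Rel (Fin n) 0ℓ
  Always _ _ = ⊤

  -- Since burning requires `t i j` and dampening its negation, the course of a guided run depends
  -- only on `t` and the burnt set, not on the values.
  Guided : Rel (Fin n) 0ℓ → Fin n → List (Fin n) → State n → State n → Set
  Guided t = Run t (λ i j → ¬ t i j)

  decreasing : ∀ i → AllPairs (λ x y → y <ᶠ x) (neighbours↓ i)
  decreasing i = AllPairs.filter⁺ (T? ∘ adj i) (AllPairs-reverse (AllPairs.tabulate⁺-< λ i<j → i<j))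

  decreasing⇒unique : ∀ {js : List (Fin n)} → AllPairs (λ x y → y <ᶠ x) js → Unique js
  decreasing⇒unique = AllPairs.map λ y<x x≡y → Fin.<⇒≢ y<x (sym x≡y)

  neighbours-unique : ∀ i → Unique (neighbours↓ i)
  neighbours-unique i = decreasing⇒unique (decreasing i)

  ∈neighbours : ∀ {i j} → Adj i j → j ∈ neighbours↓ i
  ∈neighbours {i} {j} ij = ∈-filter⁺ (T? ∘ adj i) (Any.reverse⁺ (∈-allFin j)) ij

  neighbours-adj : ∀ i → All (Adj i) (neighbours↓ i)
  neighbours-adj i = All.all-filter (T? ∘ adj i) (reverse (allFin n))

  occurrences-neighbours : ∀ x j → occurrences x (neighbours↓ j) ≡ multiplicity x j
  occurrences-neighbours x j rewrite symmetric x j with T? (adj j x)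
  ... | yes jx = trans (occurrences-∈ x _ (neighbours-unique j) (∈neighbours jx)) (sym (if-T jx))
    where
    if-T : ∀ {b} → T b → (if b then 1 else 0) ≡ 1
    if-T {true} _ = refl
  ... | no ¬jx = trans (occurrences-∉ x _ (λ x∈ → ¬jx (All-lookup (neighbours-adj j) x∈))) (sym (if-¬T ¬jx))
    where
    if-¬T : ∀ {b} → ¬ T b → (if b then 1 else 0) ≡ 0
    if-¬T {true}  ¬tt = contradiction tt ¬tt
    if-¬T {false} _   = refl

  module _ {Y N : Rel (Fin n) 0ℓ} where

    run-burnt : ∀ {i js s s′} → Run Y N i js s s′ → ∀ x → lookup (burnt s) x ≡ true → lookup (burnt s′) x ≡ true
    run-burnt done                x Bx = Bx
    run-burnt (skip _ R)          x Bx = run-burnt R x Bx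
    run-burnt (burns {j = j} {s = s} _ _ _ R₁ R₂) x Bx = run-burnt R₂ x (run-burnt R₁ x (insert-mono (burnt s) j x Bx))
    run-burnt (damps _ _ _ R)     x Bx = run-burnt R x Bx

    run-unburnt : ∀ {i js s s′} → Run Y N i js s s′ → ∀ x → lookup (burnt s′) x ≡ false → lookup (burnt s) x ≡ false
    run-unburnt R x = antimono (run-burnt R x)

    run-edges : ∀ {i js s s′ e} → Run Y N i js s s′ → e ∈ edges s → e ∈ edges s′
    run-edges done                e∈ = e∈
    run-edges (skip _ R)          e∈ = run-edges R e∈
    run-edges (burns _ _ _ R₁ R₂) e∈ = run-edges R₂ (run-edges R₁ (there e∈))
    run-edges (damps _ _ _ R)     e∈ = run-edges R e∈

    -- A vertex burns only at value 0, and the value of a burnt vertex never changes again.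
    run-final-zero : ∀ {i js s s′} → Run Y N i js s s′ → ∀ x → (lookup (burnt s) x ≡ true → lookup (value s) x ≡ 0) →
                     lookup (burnt s′) x ≡ true → lookup (value s′) x ≡ 0
    run-final-zero done       x zero-if B′x = zero-if B′x
    run-final-zero (skip _ R) x zero-if B′x = run-final-zero R x zero-if B′x
    run-final-zero (burns {j = j} {s = s} Bj vj _ R₁ R₂) x zero-if B′x =
      run-final-zero R₂ x (run-final-zero R₁ x zero-if′) B′x
      where
      zero-if′ : lookup (burnt s [ j ]≔ inside) x ≡ true → lookup (value s) x ≡ 0
      zero-if′ B⁺x with insert-inv (burnt s) j x B⁺x
      ... | inj₁ refl = vj
      ... | inj₂ Bx   = zero-if Bx
    run-final-zero (damps {j = j} {q = q} {s = s} Bj vj _ R) x zero-if B′x = run-final-zero R x zero-if′ B′x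
      where
      zero-if′ : lookup (burnt s) x ≡ true → lookup (value s [ j ]≔ q) x ≡ 0
      zero-if′ Bx with x ≟ᶠ j
      ... | yes refl = contradiction Bj (t≢f Bx)
      ... | no x≢j   = trans (lookup∘update′ x≢j (value s) q) (zero-if Bx)

    -- This dates the edges: in `guide` it tells which of two consecutive runs added a given edge,
    -- from what was still unburnt in between.
    run-new-edges : ∀ {i js s s′ a b} → Run Y N i js s s′ → (a , b) ∈ edges s′ →
      (a , b) ∈ edges s ⊎ (lookup (burnt s) b ≡ false × ((a ≡ i × b ∈ js) ⊎ lookup (burnt s) a ≡ false))
    run-new-edges done e∈ = inj₁ e∈
    run-new-edges (skip _ R) e∈ with run-new-edges R e∈
    ... | inj₁ e∈E                     = inj₁ e∈E
    ... | inj₂ (Bb , inj₁ (a≡i , b∈)) = inj₂ (Bb , inj₁ (a≡i , there b∈))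
    ... | inj₂ (Bb , inj₂ Ba)         = inj₂ (Bb , inj₂ Ba)
    run-new-edges (damps _ _ _ R) e∈ with run-new-edges R e∈
    ... | inj₁ e∈E                     = inj₁ e∈E
    ... | inj₂ (Bb , inj₁ (a≡i , b∈)) = inj₂ (Bb , inj₁ (a≡i , there b∈))
    ... | inj₂ (Bb , inj₂ Ba)         = inj₂ (Bb , inj₂ Ba)
    run-new-edges {a = a} {b} (burns {j = j} {s = s} Bj _ _ R₁ R₂) e∈ with run-new-edges R₂ e∈
    ... | inj₂ (Bb , inj₁ (a≡i , b∈)) = inj₂ (insert-false (burnt s) j b (run-unburnt R₁ b Bb) , inj₁ (a≡i , there b∈))
    ... | inj₂ (Bb , inj₂ Ba)         =
      inj₂ (insert-false (burnt s) j b (run-unburnt R₁ b Bb) , inj₂ (insert-false (burnt s) j a (run-unburnt R₁ a Ba)))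
    ... | inj₁ e∈E₁ with run-new-edges R₁ e∈E₁
    ...   | inj₁ (here refl)               = inj₂ (Bj , inj₁ (refl , here refl))
    ...   | inj₁ (there e∈E)               = inj₁ e∈E
    ...   | inj₂ (Bb , inj₁ (refl , _))   = inj₂ (insert-false (burnt s) j b Bb , inj₂ Bj)
    ...   | inj₂ (Bb , inj₂ Ba)           = inj₂ (insert-false (burnt s) j b Bb , inj₂ (insert-false (burnt s) j a Ba))

    module _ {r : Fin n} where

      open Growth H r

      run-grown : ∀ {i js s s′} → Run Y N i js s s′ → lookup (burnt s) i ≡ true → All (Adj i) js →
                  Grown (burnt s) (edges s) → Grown (burnt s′) (edges s′)
      run-grown done                _  _         g = g
      run-grown (skip _ R)          Bi (_ ∷ adj) g = run-grown R Bi adj g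
      run-grown (damps _ _ _ R)     Bi (_ ∷ adj) g = run-grown R Bi adj g
      run-grown {i} (burns {j = j} {s = s} Bj _ _ R₁ R₂) Bi (ij ∷ adj) g =
        run-grown R₂ (run-burnt R₁ i (insert-mono (burnt s) j i Bi)) adj
          (run-grown R₁ (lookup∘update j (burnt s) inside) (neighbours-adj j) (grow Bi Bj ij g))

      -- A run follows the tree it builds: a dampened edge (i, j) is not added later, since i visits j only once
      -- and (j, i) would require i to be unburnt.
      guide : ∀ {t i js s s′} → Run Y N i js s s′ → lookup (burnt s) i ≡ true → Unique js → All (Adj i) js →
              Grown (burnt s) (edges s) → (∀ {a b} → (a , b) ∈ edges s′ → t a b) →
              -- Completeness is demanded only of edges the run is responsible for: the tail burns
              -- during the run, or is `i` with the head still to be visited. In this form it passes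
              -- to the nested runs.
              (∀ {a b} → (lookup (burnt s′) a ≡ true × lookup (burnt s) a ≡ false) ⊎ (a ≡ i × b ∈ js) →
                 lookup (burnt s) b ≡ false → t a b → Joined (edges s′) a b) →
              Guided t i js s s′
      guide done _ _ _ _ _ _ = done
      guide (skip Bj R) Bi (_ ∷ uniq) (_ ∷ adj) g sound complete =
        skip Bj (guide R Bi uniq adj g sound λ where
          (inj₁ new) → complete (inj₁ new)
          (inj₂ (a≡i , b∈)) → complete (inj₂ (a≡i , there b∈)))
      guide {t} {i} (damps {j = j} {q = q} {s = s} Bj vj _ R) Bi (j≢ ∷ uniq) (_ ∷ adj) g sound complete =
        damps Bj vj ¬tij (guide R Bi uniq adj g sound λ where
          (inj₁ new) → complete (inj₁ new)
          (inj₂ (a≡i , b∈)) → complete (inj₂ (a≡i , there b∈)))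
        where
        ¬tij : ¬ t i j
        ¬tij tij with complete (inj₂ (refl , here refl)) Bj tij
        ... | inj₁ ij∈ with run-new-edges R ij∈
        ...   | inj₁ ij∈E                = t≢f (proj₂ (grown-endpoints g ij∈E)) Bj
        ...   | inj₂ (_ , inj₁ (_ , j∈)) = All-lookup j≢ j∈ refl
        ...   | inj₂ (_ , inj₂ Bi′)      = t≢f Bi Bi′
        ¬tij tij | inj₂ ji∈ with run-new-edges R ji∈
        ...   | inj₁ ji∈E      = t≢f (proj₁ (grown-endpoints g ji∈E)) Bj
        ...   | inj₂ (Bi′ , _) = t≢f Bi Bi′
      guide {t} {i} {s′ = s′} (burns {j = j} {js} {s = s} {s₁} Bj vj _ R₁ R₂) Bi (_ ∷ uniq) (ij ∷ adj) g sound complete =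
        burns Bj vj (sound (run-edges R₂ (run-edges R₁ (here refl))))
          (guide R₁ (lookup∘update j (burnt s) inside) (neighbours-unique j) (neighbours-adj j) (grow Bi Bj ij g)
            (sound ∘ run-edges R₂) complete₁)
          (guide R₂ B₁i uniq adj g₁ sound complete₂)
        where
        B₁i : lookup (burnt s₁) i ≡ true
        B₁i = run-burnt R₁ i (insert-mono (burnt s) j i Bi)

        B₁j : lookup (burnt s₁) j ≡ true
        B₁j = run-burnt R₁ j (lookup∘update j (burnt s) inside)

        g₁ : Grown (burnt s₁) (edges s₁)
        g₁ = run-grown R₁ (lookup∘update j (burnt s) inside) (neighbours-adj j) (grow Bi Bj ij g)

        -- `R₂` only adds edges whose head is unburnt at `s₁` and whose tail is `i` or unburnt at
        -- `s₁`. A vertex burnt during `ignite` and `R₁` is none of these, so all its edges are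
        -- present at `s₁`.
        older : ∀ {a b} → lookup (burnt s₁) a ≡ true → lookup (burnt s) a ≡ false → Joined (edges s′) a b → Joined (edges s₁) a b
        older B₁a Ba (inj₁ e∈) with run-new-edges R₂ e∈
        ... | inj₁ e∈E₁                = inj₁ e∈E₁
        ... | inj₂ (_ , inj₁ (refl , _)) = contradiction Ba (t≢f Bi)
        ... | inj₂ (_ , inj₂ B₁a′)      = contradiction B₁a′ (t≢f B₁a)
        older B₁a Ba (inj₂ e∈) with run-new-edges R₂ e∈
        ... | inj₁ e∈E₁        = inj₂ e∈E₁
        ... | inj₂ (B₁a′ , _) = contradiction B₁a′ (t≢f B₁a)

        complete₁ : ∀ {a b} → (lookup (burnt s₁) a ≡ true × lookup (burnt s [ j ]≔ inside) a ≡ false) ⊎ (a ≡ j × b ∈ neighbours↓ j) →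
                    lookup (burnt s [ j ]≔ inside) b ≡ false → t a b → Joined (edges s₁) a b
        complete₁ {a} {b} (inj₁ (B₁a , B⁺a)) B⁺b tab =
          older B₁a Ba (complete (inj₁ (run-burnt R₂ a B₁a , Ba)) (insert-false (burnt s) j b B⁺b) tab)
          where
          Ba : lookup (burnt s) a ≡ false
          Ba = insert-false (burnt s) j a B⁺a
        complete₁ {a} {b} (inj₂ (refl , _)) B⁺b tab =
          older B₁j Bj (complete (inj₁ (run-burnt R₂ j B₁j , Bj)) (insert-false (burnt s) j b B⁺b) tab)

        complete₂ : ∀ {a b} → (lookup (burnt s′) a ≡ true × lookup (burnt s₁) a ≡ false) ⊎ (a ≡ i × b ∈ js) →
                    lookup (burnt s₁) b ≡ false → t a b → Joined (edges s′) a b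
        complete₂ {a} {b} where′ B₁b = complete (extend where′) (insert-false (burnt s) j b (run-unburnt R₁ b B₁b))
          where
          extend : (lookup (burnt s′) a ≡ true × lookup (burnt s₁) a ≡ false) ⊎ (a ≡ i × b ∈ js) →
                   (lookup (burnt s′) a ≡ true × lookup (burnt s) a ≡ false) ⊎ (a ≡ i × b ∈ j ∷ js)
          extend (inj₁ (B′a , B₁a)) = inj₁ (B′a , insert-false (burnt s) j a (run-unburnt R₁ a B₁a))
          extend (inj₂ (a≡i , b∈))  = inj₂ (a≡i , there b∈)

  -- `dfs` returns silently on fuel 0, so the fuel must be shown sufficient. An unburnt `j` makes
  -- the measure positive, and burning it pays for the unit of fuel spent by the nested call.
  foldl-run : ∀ fuel i js s → unburnt (burnt s) ≤ fuel → Run Always Always i js s (foldl (visit fuel i) s js)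
  foldl-run fuel i []       s enough = done
  foldl-run fuel i (j ∷ js) s enough with lookup (burnt s) j in Bj | lookup (value s) j in vj
  ... | true  | _     = skip Bj (foldl-run fuel i js s enough)
  ... | false | suc q = damps Bj vj _ (foldl-run fuel i js _ enough)
  foldl-run zero       i (j ∷ js) s enough | false | zero
    with () ← subst (_≤ zero) (unburnt-insert (burnt s) j Bj) enough
  foldl-run (suc fuel) i (j ∷ js) s enough | false | zero =
    burns Bj vj _ R₁ (foldl-run (suc fuel) i js s₁ (ℕ.≤-trans (unburnt-mono (burnt s [ j ]≔ inside) (burnt s₁) (run-burnt R₁)) (ℕ.m≤n⇒m≤1+n enough′)))
    where
    enough′ : unburnt (burnt s [ j ]≔ inside) ≤ fuel
    enough′ = ℕ.≤-pred (subst (_≤ suc fuel) (unburnt-insert (burnt s) j Bj) enough)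

    s₁ : State n
    s₁ = dfs (suc fuel) j (ignite i j s)

    R₁ : Run Always Always j (neighbours↓ j) (ignite i j s) s₁
    R₁ = foldl-run fuel j (neighbours↓ j) (ignite i j s) enough′

  unburnt-⁅⁆ : ∀ {n} (r : Fin n) → unburnt ⁅ r ⁆ < n
  unburnt-⁅⁆ {suc n} r = s≤s (ℕ.≤-reflexive (trans (∣∁p∣≡n∸∣p∣ ⁅ r ⁆) (cong (suc n ∸_) (∣⁅x⁆∣≡1 r))))

  burn-run : ∀ r Q → Run Always Always r (neighbours↓ r) (state ⁅ r ⁆ Q []) (burn r Q)
  burn-run r Q = dfs-run n (unburnt-⁅⁆ r)
    where
    dfs-run : ∀ fuel → unburnt ⁅ r ⁆ < fuel →
              Run Always Always r (neighbours↓ r) (state ⁅ r ⁆ Q []) (dfs fuel r (state ⁅ r ⁆ Q []))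
    dfs-run (suc fuel) (s≤s enough) = foldl-run fuel r (neighbours↓ r) _ enough

  -- Burnt set and values decide each visit. The labels may differ, so that a guided run built by
  -- hand can be identified with the run of the algorithm.
  run-deterministic : ∀ {Y N Y′ N′ i js s s₁ s₂} → Run Y N i js s s₁ → Run Y′ N′ i js s s₂ → s₁ ≡ s₂
  run-deterministic done done = refl
  run-deterministic (skip _ R) (skip _ R′) = run-deterministic R R′
  run-deterministic (skip Bj _) (burns ¬Bj _ _ _ _) = contradiction ¬Bj (t≢f Bj)
  run-deterministic (skip Bj _) (damps ¬Bj _ _ _) = contradiction ¬Bj (t≢f Bj)
  run-deterministic (burns ¬Bj _ _ _ _) (skip Bj _) = contradiction ¬Bj (t≢f Bj)
  run-deterministic (damps ¬Bj _ _ _) (skip Bj _) = contradiction ¬Bj (t≢f Bj)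
  run-deterministic (burns _ _ _ R₁ R₂) (burns _ _ _ R₁′ R₂′) with refl ← run-deterministic R₁ R₁′ = run-deterministic R₂ R₂′
  run-deterministic (burns _ v≡0 _ _ _) (damps _ v≡1+q _ _) with () ← trans (sym v≡0) v≡1+q
  run-deterministic (damps _ v≡1+q _ _) (burns _ v≡0 _ _ _) with () ← trans (sym v≡0) v≡1+q
  run-deterministic (damps _ v≡1+q _ R) (damps _ v≡1+q′ _ R′)
    with refl ← trans (sym v≡1+q) v≡1+q′ = run-deterministic R R′

  -- Recovering a run from its tree

  undampen : ∀ (v : Vec ℕ n) j {q} → lookup v j ≡ suc q → v ≡ (v [ j ]≔ q) [ j ]≔ suc (lookup (v [ j ]≔ q) j)
  undampen v j {q} vj = sym (trans ([]≔-idempotent v j)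
    (trans (cong (λ k → v [ j ]≔ k) (trans (cong suc (lookup∘update j v q)) (sym vj))) ([]≔-lookup v j)))

  -- Equality of burnt sets travels forwards and, with the common guide, forces the same kind of
  -- visit in both runs. Equality of values travels backwards, as `undampen` expresses the earlier
  -- values through the later ones.
  guided-injective : ∀ {t i js s₁ s₁′ s₂ s₂′} → Guided t i js s₁ s₁′ → Guided t i js s₂ s₂′ → burnt s₁ ≡ burnt s₂ →
                     burnt s₁′ ≡ burnt s₂′ × (value s₁′ ≡ value s₂′ → value s₁ ≡ value s₂)
  guided-injective done done B≡ = B≡ , λ v≡ → v≡
  guided-injective (skip _ R) (skip _ R′) B≡ = guided-injective R R′ B≡
  guided-injective (burns _ _ _ R₁ R₂) (burns _ _ _ R₁′ R₂′) B≡
    with B₁≡ , v₁⇒v ← guided-injective R₁ R₁′ (cong (_[ _ ]≔ inside) B≡)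
    with B₂≡ , v₂⇒v₁ ← guided-injective R₂ R₂′ B₁≡ = B₂≡ , λ v≡ → v₁⇒v (v₂⇒v₁ v≡)
  guided-injective (damps {j = j} {s = s} _ vj _ R) (damps {s = s′} _ v′j _ R′) B≡
    with B′≡ , v⇒v ← guided-injective R R′ B≡ = B′≡ , λ v≡ →
      trans (undampen (value s) j vj)
        (trans (cong (λ v → v [ j ]≔ suc (lookup v j)) (v⇒v v≡)) (sym (undampen (value s′) j v′j)))
  guided-injective (skip Bj _) (burns ¬Bj _ _ _ _) refl = contradiction ¬Bj (t≢f Bj)
  guided-injective (skip Bj _) (damps ¬Bj _ _ _) refl = contradiction ¬Bj (t≢f Bj)
  guided-injective (burns ¬Bj _ _ _ _) (skip Bj _) refl = contradiction ¬Bj (t≢f Bj)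
  guided-injective (damps ¬Bj _ _ _) (skip Bj _) refl = contradiction ¬Bj (t≢f Bj)
  guided-injective (burns _ _ tij _ _) (damps _ _ ¬tij _) _ = contradiction tij ¬tij
  guided-injective (damps _ _ ¬tij _) (burns _ _ tij _ _) _ = contradiction tij ¬tij

  -- Burnt vertices and edges are computed forwards along t, and only then the initial values backwards from the
  -- final ones.
  Completion : Rel (Fin n) 0ℓ → Fin n → List (Fin n) → Subset n → Edges n → Set
  Completion t i js B E = ∃₂ λ B′ E′ → (∀ x → lookup B x ≡ true → lookup B′ x ≡ true) ×
    (∀ v′ → (∀ x → lookup B′ x ≡ true → lookup v′ x ≡ 0) →
      ∃ λ v → Guided t i js (state B v E) (state B′ v′ E′) × (∀ x → lookup B x ≡ true → lookup v x ≡ lookup v′ x))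

  module _ {t : Rel (Fin n) 0ℓ} {i j : Fin n} {js : List (Fin n)} {B : Subset n} {E : Edges n} where

    completion-skip : lookup B j ≡ true → Completion t i js B E → Completion t i (j ∷ js) B E
    completion-skip Bj (B′ , E′ , mono , back) =
      B′ , E′ , mono , λ v′ v′≡0 → let v , R , v≡ = back v′ v′≡0 in v , skip Bj R , v≡

    completion-damps : lookup B j ≡ false → ¬ t i j → Completion t i js B E → Completion t i (j ∷ js) B E
    completion-damps Bj ¬tij (B′ , E′ , mono , back) = B′ , E′ , mono , λ v′ v′≡0 →
      let v , R , v≡ = back v′ v′≡0
          undo       = trans ([]≔-idempotent v j) ([]≔-lookup v j)
      in v [ j ]≔ suc (lookup v j)
         , damps Bj (lookup∘update j v _) ¬tij (subst (λ w → Guided t i js (state B w E) (state B′ v′ E′)) (sym undo) R)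
         , λ x Bx → trans (lookup∘update′ (λ { refl → t≢f Bx Bj }) v _) (v≡ x Bx)

    completion-burns : lookup B j ≡ false → t i j →
      (C : Completion t j (neighbours↓ j) (B [ j ]≔ inside) ((i , j) ∷ E)) →
      Completion t i js (proj₁ C) (proj₁ (proj₂ C)) → Completion t i (j ∷ js) B E
    completion-burns Bj tij (B₁ , E₁ , mono₁ , back₁) (B₂ , E₂ , mono₂ , back₂) =
      B₂ , E₂ , (λ x Bx → mono₂ x (mono₁ x (insert-mono B j x Bx))) , λ v′ v′≡0 →
        let v₁ , R₂ , v₁≡ = back₂ v′ v′≡0
            -- On vertices burnt by then, the values between the two runs agree with the final ones
            -- and so vanish, as `back₁` demands. The same agreement for `j` shows that its value is
            -- 0 when it burns.
            v₁≡0          = λ x B₁x → trans (v₁≡ x B₁x) (v′≡0 x (mono₂ x B₁x))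
            v , R₁ , v≡   = back₁ v₁ v₁≡0
            B⁺j           = lookup∘update j B inside
        in v , burns Bj (trans (v≡ j B⁺j) (v₁≡0 j (mono₁ j B⁺j))) tij R₁ R₂
           , λ x Bx → trans (v≡ x (insert-mono B j x Bx)) (v₁≡ x (mono₁ x (insert-mono B j x Bx)))

  completion : ∀ {t} → (∀ a b → Dec (t a b)) → ∀ fuel i js B E → unburnt B ≤ fuel → Completion t i js B E
  completion t? fuel i [] B E enough = B , E , (λ x Bx → Bx) , λ v′ _ → v′ , done , λ x _ → refl
  completion t? fuel i (j ∷ js) B E enough with lookup B j in Bj | t? i j
  ... | true  | _       = completion-skip Bj (completion t? fuel i js B E enough)
  ... | false | no ¬tij = completion-damps Bj ¬tij (completion t? fuel i js B E enough)
  completion t? zero i (j ∷ js) B E enough | false | yes _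
    with () ← subst (_≤ zero) (unburnt-insert B j Bj) enough
  completion {t} t? (suc fuel) i (j ∷ js) B E enough | false | yes tij = completion-burns Bj tij C
    (completion t? (suc fuel) i js _ _
      (ℕ.≤-trans (unburnt-mono (B [ j ]≔ inside) (proj₁ C) (proj₁ (proj₂ (proj₂ C)))) (ℕ.m≤n⇒m≤1+n enough′)))
    where
    enough′ : unburnt (B [ j ]≔ inside) ≤ fuel
    enough′ = ℕ.≤-pred (subst (_≤ suc fuel) (unburnt-insert B j Bj) enough)

    C : Completion t j (neighbours↓ j) (B [ j ]≔ inside) ((i , j) ∷ E)
    C = completion t? fuel j (neighbours↓ j) (B [ j ]≔ inside) ((i , j) ∷ E) enough′

  module _ {t N : Rel (Fin n) 0ℓ} (t⇒adj : ∀ {a b} → t a b → Adj a b) (N⇒¬t : ∀ {a b} → N a b → ¬ t a b) where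

    closed-here : ∀ {i js s s′ b} → Run t N i js s s′ → b ∈ js → t i b → lookup (burnt s′) b ≡ true
    closed-here (skip Bj R)                          (here refl) tib = run-burnt R _ Bj
    closed-here (burns {j = j} {s = s} _ _ _ R₁ R₂) (here refl) tib =
      run-burnt R₂ j (run-burnt R₁ j (lookup∘update j (burnt s) inside))
    closed-here (damps _ _ Nij _)   (here refl) tib = contradiction tib (N⇒¬t Nij)
    closed-here (skip _ R)          (there b∈)  tib = closed-here R b∈ tib
    closed-here (burns _ _ _ R₁ R₂) (there b∈)  tib = closed-here R₂ b∈ tib
    closed-here (damps _ _ _ R)     (there b∈)  tib = closed-here R b∈ tib

    -- When `a` burns, a nested run visits all its neighbours. `closed-here` applied to that run
    -- burns `b`, and burnt vertices stay burnt.
    closed-new : ∀ {i js s s′ a b} → Run t N i js s s′ → lookup (burnt s′) a ≡ true → lookup (burnt s) a ≡ false →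
                 t a b → lookup (burnt s′) b ≡ true
    closed-new done B′a Ba tab = contradiction Ba (t≢f B′a)
    closed-new (skip _ R) B′a Ba tab = closed-new R B′a Ba tab
    closed-new (damps _ _ _ R) B′a Ba tab = closed-new R B′a Ba tab
    closed-new {a = a} {b} (burns {j = j} {s = s} {s₁} _ _ _ R₁ R₂) B′a Ba tab with lookup (burnt s₁) a in B₁a
    ... | false = closed-new R₂ B′a B₁a tab
    ... | true with a ≟ᶠ j
    ...   | yes refl = run-burnt R₂ b (closed-here R₁ (∈neighbours (t⇒adj tab)) tab)
    ...   | no a≢j   = run-burnt R₂ b (closed-new R₁ B₁a (trans (lookup∘update′ a≢j (burnt s) inside) Ba) tab)

  module _ {Y N : Rel (Fin n) 0ℓ} where

    run-followed : ∀ {i js s s′ a b} → Run Y N i js s s′ → (a , b) ∈ edges s′ → (a , b) ∈ edges s ⊎ Y a b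
    run-followed done            e∈ = inj₁ e∈
    run-followed (skip _ R)      e∈ = run-followed R e∈
    run-followed (damps _ _ _ R) e∈ = run-followed R e∈
    run-followed (burns _ _ Yij R₁ R₂) e∈ with run-followed R₂ e∈
    ... | inj₂ Yab = inj₂ Yab
    ... | inj₁ e∈E₁ with run-followed R₁ e∈E₁
    ...   | inj₂ Yab         = inj₂ Yab
    ...   | inj₁ (here refl) = inj₂ Yij
    ...   | inj₁ (there e∈E) = inj₁ e∈E

    -- Visits counted against burnt neighbours

    private
      degree : Subset n → Fin n → ℕ
      degree B x = weight B (multiplicity x)

      cancel : ∀ a b c d e → a + (e + b) ≡ c + e + d → a + b ≡ c + d
      cancel a b c d e eq = ℕ.+-cancelˡ-≡ e _ _ (trans (lhs e a b) (trans eq (rhs c e d)))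
        where
        lhs : ∀ e a b → e + (a + b) ≡ a + (e + b)
        lhs = solve-∀
        rhs : ∀ c e d → c + e + d ≡ e + (c + d)
        rhs = solve-∀

    -- Every vertex burnt during the run has visited x, and all these visits were dampened.
    run-count : ∀ {i js s s′} → Run Y N i js s s′ → ∀ x → lookup (burnt s′) x ≡ false →
                lookup (value s) x + degree (burnt s) x ≡ lookup (value s′) x + occurrences x js + degree (burnt s′) x
    -- Burning `j` raises the degree of `x` by `multiplicity x j`, and the nested run from `j`
    -- visits `x` equally often; the two contributions cancel.
    burn-count : ∀ {i j s s₁} → lookup (burnt s) j ≡ false → Run Y N j (neighbours↓ j) (ignite i j s) s₁ →
                 ∀ x → lookup (burnt s₁) x ≡ false →
                 lookup (value s) x + degree (burnt s) x ≡ lookup (value s₁) x + degree (burnt s₁) x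

    run-count (done {s = s}) x B′x = cong (_+ degree (burnt s) x) (sym (ℕ.+-identityʳ (lookup (value s) x)))
    run-count (skip {j = j} {js} {s} {s′} Bj R) x B′x = trans (run-count R x B′x)
      (cong (λ k → lookup (value s′) x + (k + occurrences x js) + degree (burnt s′) x) (sym (indicator-≢ x≢j)))
      where
      x≢j : x ≢ j
      x≢j refl = t≢f (run-burnt R x Bj) B′x
    run-count (burns {j = j} {js} {s} {s₁} {s₂} Bj _ _ R₁ R₂) x B′x =
      trans (burn-count Bj R₁ x (run-unburnt R₂ x B′x))
        (trans (run-count R₂ x B′x)
          (cong (λ k → lookup (value s₂) x + (k + occurrences x js) + degree (burnt s₂) x) (sym (indicator-≢ x≢j))))
      where
      x≢j : x ≢ j
      x≢j refl = t≢f (run-burnt R₂ x (run-burnt R₁ x (lookup∘update x (burnt s) inside))) B′x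
    run-count (damps {j = j} {js} {q} {s} {s′} Bj vj _ R) x B′x with x ≟ᶠ j
    ... | no x≢j = trans (cong (_+ degree (burnt s) x) (sym (lookup∘update′ x≢j (value s) q))) (run-count R x B′x)
    ... | yes refl = trans (cong (_+ degree (burnt s) x) vj)
      (trans (cong (λ k → suc (k + degree (burnt s) x)) (sym (lookup∘update x (value s) q)))
        (trans (cong suc (run-count R x B′x)) (move (lookup (value s′) x) (occurrences x js) (degree (burnt s′) x))))
      where
      move : ∀ a b c → suc (a + b + c) ≡ a + suc b + c
      move = solve-∀

    burn-count {j = j} {s} {s₁} Bj R₁ x B₁x = cancel (lookup (value s) x) (degree (burnt s) x) (lookup (value s₁) x) (degree (burnt s₁) x) (multiplicity x j)
      (trans (cong (lookup (value s) x +_) (sym (weight-insert (burnt s) j (multiplicity x) Bj)))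
        (trans (run-count R₁ x B₁x)
          (cong (λ k → lookup (value s₁) x + k + degree (burnt s₁) x) (occurrences-neighbours x j))))

    -- Dhar's criterion: the unburnt vertices would violate the parking condition.
    parking⇒all-burnt : ∀ {r Q s′} → Parking H Q → Run Y N r (neighbours↓ r) (state ⁅ r ⁆ Q []) s′ →
                        ∀ x → lookup (burnt s′) x ≡ true
    parking⇒all-burnt {r} {Q} {s′} park R x with lookup (burnt s′) x in B′x
    ... | true  = refl
    ... | false with park (∁ (burnt s′)) x r (trans (lookup-∁ (burnt s′) x) (cong not B′x))
                       (trans (lookup-∁ (burnt s′) r) (cong not (run-burnt R r (⁅⁆-true r))))
    ...   | y , Ay , Q< = contradiction Q<
      (ℕ.≤⇒≯ (ℕ.≤-trans (ℕ.≤-reflexive (coweight-∁ (burnt s′) (multiplicity y)))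
        (ℕ.≤-trans (ℕ.m≤n+m _ (lookup (value s′) y)) (ℕ.≤-reflexive (sym count)))))
      where
      B′y : lookup (burnt s′) y ≡ false
      B′y with lookup (burnt s′) y | trans (sym (lookup-∁ (burnt s′) y)) Ay
      ... | false | _ = refl

      -- The initial degree of `y` counts only `r`; it cancels against the visits from `r`.
      count : lookup Q y ≡ lookup (value s′) y + degree (burnt s′) y
      count = ℕ.+-cancelʳ-≡ (multiplicity y r) _ _
        (trans (cong (lookup Q y +_) (sym (weight-⁅⁆ r (multiplicity y))))
          (trans (run-count R y B′y)
            (trans (cong (λ k → lookup (value s′) y + k + degree (burnt s′) y) (occurrences-neighbours y r))
              (swap₂₃ (lookup (value s′) y) (multiplicity y r) (degree (burnt s′) y)))))
        where
        swap₂₃ : ∀ a b c → a + b + c ≡ a + c + b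
        swap₂₃ = solve-∀

    -- The first vertex of A to be burnt has been visited only from outside A.
    first-burnt : ∀ {i js s s′} (A : Subset n) → Run Y N i js s s′ →
      (∀ x → lookup (burnt s) x ≡ true → lookup A x ≡ false) →
      (∀ x → lookup (burnt s′) x ≡ true → lookup A x ≡ false) ⊎
      (∃ λ x → lookup A x ≡ true × lookup (value s) x + degree (burnt s) x < occurrences x js + coweight A (multiplicity x))
    first-burnt A done B∩A = inj₁ B∩A
    first-burnt A (skip {j = j} {js} {s} _ R) B∩A with first-burnt A R B∩A
    ... | inj₁ B′∩A          = inj₁ B′∩A
    ... | inj₂ (x , Ax , v<) = inj₂ (x , Ax , ℕ.≤-trans v< (ℕ.+-monoˡ-≤ _ (ℕ.m≤n+m (occurrences x js) (indicator x j))))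
    first-burnt A (damps {j = j} {js} {q} {s} Bj vj _ R) B∩A with first-burnt A R B∩A
    ... | inj₁ B′∩A          = inj₁ B′∩A
    ... | inj₂ (x , Ax , v<) = inj₂ (x , Ax , v<′)
      where
      v<′ : lookup (value s) x + degree (burnt s) x < indicator x j + occurrences x js + coweight A (multiplicity x)
      v<′ with x ≟ᶠ j
      ... | no x≢j   = subst (λ k → k + degree (burnt s) x < occurrences x js + coweight A (multiplicity x))
                         (lookup∘update′ x≢j (value s) q) v<
      ... | yes refl = subst (λ k → k + degree (burnt s) x < suc (occurrences x js + coweight A (multiplicity x))) (sym vj)
                         (s≤s (subst (λ k → k + degree (burnt s) x < occurrences x js + coweight A (multiplicity x))
                           (lookup∘update x (value s) q) v<))
    first-burnt A (burns {j = j} {js} {s} {s₁} {s₂} Bj vj _ R₁ R₂) B∩A with lookup A j in Aj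
    -- `j` is the first vertex of `A` to burn: its value is 0 and its burnt neighbours lie outside
    -- `A`. The visit in progress supplies the 1 that makes the inequality strict.
    ... | true = inj₂ (j , Aj , subst (λ k → k + degree (burnt s) j < indicator j j + occurrences j js + coweight A (multiplicity j)) (sym vj)
                    (subst (λ k → degree (burnt s) j < k + occurrences j js + coweight A (multiplicity j)) (sym (indicator-≡ j))
                      (s≤s (ℕ.≤-trans degree≤ (ℕ.m≤n+m _ (occurrences j js))))))
      where
      degree≤ : degree (burnt s) j ≤ coweight A (multiplicity j)
      degree≤ = ℕ.≤-trans (weight-mono (burnt s) (∁ A) (multiplicity j)
                  (λ x Bx → trans (lookup-∁ A x) (cong not (B∩A x Bx))))
                (ℕ.≤-reflexive (weight-∁ A (multiplicity j)))
    ... | false with first-burnt A R₁ B⁺∩A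
      where
      B⁺∩A : ∀ x → lookup (burnt s [ j ]≔ inside) x ≡ true → lookup A x ≡ false
      B⁺∩A x B⁺x with insert-inv (burnt s) j x B⁺x
      ... | inj₁ refl = Aj
      ... | inj₂ Bx   = B∩A x Bx
    ...   | inj₂ (x , Ax , v<) = inj₂ (x , Ax , ℕ.≤-trans v<′ (ℕ.m≤n+m _ (indicator x j + occurrences x js)))
      where
      shift : ∀ a b c → suc (a + (b + c)) ≡ b + suc (a + c)
      shift = solve-∀

      v<′ : lookup (value s) x + degree (burnt s) x < coweight A (multiplicity x)
      v<′ = ℕ.+-cancelˡ-≤ (multiplicity x j) _ _
        (subst (_≤ multiplicity x j + coweight A (multiplicity x)) (shift (lookup (value s) x) (multiplicity x j) (degree (burnt s) x))
          (subst (λ k → lookup (value s) x + k < multiplicity x j + coweight A (multiplicity x)) (weight-insert (burnt s) j (multiplicity x) Bj)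
            (subst (λ k → lookup (value s) x + degree (burnt s [ j ]≔ inside) x < k + coweight A (multiplicity x))
              (occurrences-neighbours x j) v<)))
    ...   | inj₁ B₁∩A with first-burnt A R₂ B₁∩A
    ...     | inj₁ B₂∩A          = inj₁ B₂∩A
    ...     | inj₂ (x , Ax , v<) = inj₂ (x , Ax ,
      ℕ.≤-trans (subst (_< occurrences x js + coweight A (multiplicity x)) (sym (burn-count Bj R₁ x B₁x)) v<)
        (ℕ.+-monoˡ-≤ _ (ℕ.m≤n+m (occurrences x js) (indicator x j))))
      where
      B₁x : lookup (burnt s₁) x ≡ false
      B₁x with lookup (burnt s₁) x in B₁x
      ... | false = refl
      ... | true  = contradiction (B₁∩A x B₁x) (t≢f Ax)

    all-burnt⇒parking : ∀ {r Q s′} → Run Y N r (neighbours↓ r) (state ⁅ r ⁆ Q []) s′ →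
      (∀ x → lookup (burnt s′) x ≡ true) → ∀ A x → lookup A x ≡ true → lookup A r ≡ false →
      ∃ λ i → lookup A i ≡ true × lookup Q i < coweight A (multiplicity i)
    all-burnt⇒parking {r} {Q} R all A x Ax Ar
      with first-burnt A R (λ y By → subst (λ z → lookup A z ≡ false) (sym (⁅⁆-≡ r y By)) Ar)
    ... | inj₁ B′∩A          = contradiction (B′∩A x (all x)) (t≢f Ax)
    ... | inj₂ (y , Ay , v<) = y , Ay , ℕ.+-cancelˡ-≤ (multiplicity y r) _ _
      (subst (_≤ multiplicity y r + coweight A (multiplicity y)) (trans (cong suc (ℕ.+-comm (lookup Q y) _)) (sym (ℕ.+-suc _ _)))
        (subst (λ k → lookup Q y + multiplicity y r < k + coweight A (multiplicity y)) (occurrences-neighbours y r)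
          (subst (λ k → lookup Q y + k < occurrences y (neighbours↓ r) + coweight A (multiplicity y)) (weight-⁅⁆ r (multiplicity y)) v<)))

    -- Visits before the first burning only dampen other entries of the list, which has no
    -- repetitions. So the first vertex to burn had value 0 from the start.
    root-child : ∀ {r js s s′} → Run Y N r js s s′ → Unique js →
      (∀ x → lookup (burnt s′) x ≡ true → lookup (burnt s) x ≡ true) ⊎ (∃ λ c → c ∈ js × lookup (value s) c ≡ 0)
    root-child done _ = inj₁ λ x B′x → B′x
    root-child (burns {j = j} _ vj _ _ _) _ = inj₂ (j , here refl , vj)
    root-child (skip _ R) (_ ∷ uniq) with root-child R uniq
    ... | inj₁ B′⊆B          = inj₁ B′⊆B
    ... | inj₂ (c , c∈ , vc) = inj₂ (c , there c∈ , vc)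
    root-child (damps {j = j} {q = q} {s = s} _ _ _ R) (j≢ ∷ uniq) with root-child R uniq
    ... | inj₁ B′⊆B          = inj₁ B′⊆B
    ... | inj₂ (c , c∈ , vc) =
      inj₂ (c , there c∈ , trans (sym (lookup∘update′ (≢-sym (All-lookup j≢ c∈)) (value s) q)) vc)

    -- The root visits its larger neighbours before anything else is burnt.
    larger-positive : ∀ {r js s s′} → Run Y N r js s s′ → (∀ x → lookup (burnt s) x ≡ true → x ≡ r) →
      AllPairs (λ x y → y <ᶠ x) js → (∀ {j} → Y r j → j <ᶠ r) → ∀ {j} → j ∈ js → r <ᶠ j → 0 < lookup (value s) j
    larger-positive (skip Bj _) only-r _ _ (here refl) r<j = contradiction (sym (only-r _ Bj)) (Fin.<⇒≢ r<j)
    larger-positive (skip {j = x} Bx _) only-r (x> ∷ _) _ (there j∈) r<j with refl ← only-r x Bx =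
      contradiction r<j (Fin.<-asym (All-lookup x> j∈))
    larger-positive (burns _ _ Yrx _ _) _ _ Y⇒< (here refl) r<j = contradiction r<j (Fin.<-asym (Y⇒< Yrx))
    larger-positive (burns _ _ Yrx _ _) _ (x> ∷ _) Y⇒< (there j∈) r<j =
      contradiction r<j (Fin.<-asym (Fin.<-trans (All-lookup x> j∈) (Y⇒< Yrx)))
    larger-positive (damps _ vj _ _) _ _ _ (here refl) r<j = subst (0 <_) (sym vj) (s≤s z≤n)
    larger-positive (damps {q = q} {s = s} _ _ _ R) only-r (x> ∷ decr) Y⇒< (there j∈) r<j =
      subst (0 <_) (lookup∘update′ (Fin.<⇒≢ (All-lookup x> j∈)) (value s) q) (larger-positive R only-r decr Y⇒< j∈ r<j)

    -- Converse to `larger-positive`: since the list decreases, only `r` is burnt while larger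
    -- vertices are visited, and each keeps its positive initial value until its turn.
    larger-dampened : ∀ {r js s s′} → Run Y N r js s s′ → (∀ x → lookup (burnt s) x ≡ true → x ≡ r) →
      AllPairs (λ x y → y <ᶠ x) js → (∀ {j} → j ∈ js → r <ᶠ j → 0 < lookup (value s) j) → ∀ {j} → j ∈ js → r <ᶠ j → N r j
    larger-dampened (skip Bj _) only-r _ _ (here refl) r<j = contradiction (sym (only-r _ Bj)) (Fin.<⇒≢ r<j)
    larger-dampened (skip {j = x} Bx _) only-r (x> ∷ _) _ (there j∈) r<j with refl ← only-r x Bx =
      contradiction r<j (Fin.<-asym (All-lookup x> j∈))
    larger-dampened (burns _ vx _ _ _) _ _ pos (here refl) r<j = contradiction (sym vx) (ℕ.<⇒≢ (pos (here refl) r<j))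
    larger-dampened (burns _ vx _ _ _) _ (x> ∷ _) pos (there j∈) r<j =
      contradiction (sym vx) (ℕ.<⇒≢ (pos (here refl) (Fin.<-trans r<j (All-lookup x> j∈))))
    larger-dampened (damps _ _ Nrj _) _ _ _ (here refl) r<j = Nrj
    larger-dampened (damps {q = q} {s = s} _ _ _ R) only-r (x> ∷ decr) pos (there j∈) r<j =
      larger-dampened R only-r decr
        (λ k∈ r<k → subst (0 <_) (sym (lookup∘update′ (Fin.<⇒≢ (All-lookup x> k∈)) (value s) q)) (pos (there k∈) r<k))
        j∈ r<j

-- The complete graph without the edge {1, n}

largest : ∀ {n} {P : Fin n → Set} → Decidable P → ∃ P → ∃ λ r → P r × (∀ j → P j → j ≤ᶠ r)
largest {suc n} {P} P? (i , Pi) with Fin.any? (P? ∘ suc)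
... | yes found with r , Pr , max ← largest (P? ∘ suc) found = suc r , Pr , λ where
  zero    _  → z≤n
  (suc j) Pj → s≤s (max j Pj)
... | no none = zero , P0 i Pi , λ { zero _ → z≤n ; (suc j) Pj → contradiction (j , Pj) none }
  where
  P0 : ∀ i → P i → P zero
  P0 zero    Pi = Pi
  P0 (suc i) Pi = contradiction (i , Pi) none

T-injective : ∀ {b c} → (T b → T c) → (T c → T b) → b ≡ c
T-injective {false} {false} _ _ = refl
T-injective {false} {true}  _ g = contradiction (g tt) λ ()
T-injective {true}  {false} f _ = contradiction (f tt) λ ()
T-injective {true}  {true}  _ _ = refl

¬T⇒T-not : ∀ {b} → ¬ T b → T (not b)
¬T⇒T-not {false} _  = tt
¬T⇒T-not {true}  ¬b = ¬b tt

T-not⇒¬T : ∀ {b} → T (not b) → ¬ T b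
T-not⇒¬T {false} _ ()

T-does : ∀ {P : Set} (P? : Dec P) → T (does P?) → P
T-does (yes p) _ = p

another : ∀ {n} → 2 ≤ n → (r : Fin n) → ∃ λ x → x ≢ r
another {suc zero}    (s≤s ()) zero
another {suc (suc n)} _ zero    = suc zero , λ ()
another {suc (suc n)} _ (suc r) = zero , λ ()

-- The deleted edge avoids the vertex 0, whose label is neither 1 nor `suc n`; the rewrites clear
-- the conjunctions still waiting for `i`.
cone : ∀ {n} (i : Fin n) → SimpleGraph.multiplicity (K-e₁ n) (suc i) zero ≡ 1
cone {suc n} i rewrite ∧-zeroʳ (label i ≡ᵇ 1) | ∧-zeroʳ (label i ≡ᵇ suc n) = refl

module CompleteMinusEdge (n : ℕ) (n≥3 : 3 ≤ n) where

  open State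

  G : SimpleGraph (suc n)
  G = K-e₁ n

  H : SimpleGraph n
  H = removeRoot G

  open SimpleGraph H
  open DFS H
  open Burning H

  n≥2 : 2 ≤ n
  n≥2 = ℕ.≤-trans (ℕ.n≤1+n 2) n≥3

  m₁ : Vec ℕ n
  m₁ = m-exponent (SimpleGraph.multiplicity G) full

  adj-intro : ∀ {i j} → i ≢ j → ¬ (label i ≡ 1 × label j ≡ n) → ¬ (label i ≡ n × label j ≡ 1) → Adj i j
  adj-intro {i} {j} i≢j ¬1n ¬n1 = Equivalence.from T-∧
    ( ¬T⇒T-not (λ eq → i≢j (T-does (i ≟ᶠ j) eq))
    , ¬T⇒T-not λ joins → ¬joins (Equivalence.to (T-∨ {(label i ≡ᵇ 1) ∧ (label j ≡ᵇ n)}) joins))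
    where
    ¬joins : ¬ (T ((label i ≡ᵇ 1) ∧ (label j ≡ᵇ n)) ⊎ T ((label i ≡ᵇ n) ∧ (label j ≡ᵇ 1)))
    ¬joins (inj₁ e) = let a , b = Equivalence.to (T-∧ {label i ≡ᵇ 1}) e in ¬1n (ℕ.≡ᵇ⇒≡ (label i) 1 a , ℕ.≡ᵇ⇒≡ (label j) n b)
    ¬joins (inj₂ e) = let a , b = Equivalence.to (T-∧ {label i ≡ᵇ n}) e in ¬n1 (ℕ.≡ᵇ⇒≡ (label i) n a , ℕ.≡ᵇ⇒≡ (label j) 1 b)

  not-1n : ∀ {i j} → label i ≡ 1 → label j ≡ n → ¬ Adj i j
  not-1n {i} {j} i≡1 j≡n ij = T-not⇒¬T (proj₂ (Equivalence.to (T-∧ {not (does (i ≟ᶠ j))}) ij))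
    (Equivalence.from (T-∨ {(label i ≡ᵇ 1) ∧ (label j ≡ᵇ n)})
      (inj₁ (Equivalence.from T-∧ (ℕ.≡⇒≡ᵇ (label i) 1 i≡1 , ℕ.≡⇒≡ᵇ (label j) n j≡n))))

  adj-irrefl : ∀ (t : SimpleGraph n) {i} → ¬ SimpleGraph.Adj t i i
  adj-irrefl t {i} = subst (λ b → ¬ T b) (sym (SimpleGraph.loopless t i)) λ ()

  multiplicity-adj : ∀ {i j} → Adj i j → multiplicity i j ≡ 1
  multiplicity-adj {i} {j} ij rewrite Equivalence.to (T-≡ {adj i j}) ij = refl

  multiplicity≤1 : ∀ i j → multiplicity i j ≤ 1
  multiplicity≤1 i j with adj i j
  ... | true  = s≤s z≤n
  ... | false = z≤n

  ∈∁⁅⁆ : ∀ {z x : Fin n} → x ≢ z → lookup (∁ ⁅ z ⁆) x ≡ true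
  ∈∁⁅⁆ {z} {x} x≢z with lookup ⁅ z ⁆ x in eq | lookup-∁ ⁅ z ⁆ x
  ... | true  | _   = contradiction (⁅⁆-≡ z x eq) x≢z
  ... | false | eq′ = eq′

  -- The parking condition for the complement of a single vertex `z` bounds some value strictly by
  -- the multiplicity of one edge, which is at most 1.
  parking-zero : ∀ {Q} → Parking H Q → ∃ λ i → lookup Q i ≡ 0
  parking-zero {Q} park = i , ℕ.n≤0⇒n≡0 (ℕ.≤-pred (ℕ.≤-trans Q< (ℕ.≤-trans
      (ℕ.≤-reflexive (trans (coweight-∁ ⁅ z ⁆ (multiplicity i)) (weight-⁅⁆ z (multiplicity i)))) (multiplicity≤1 i z))))
    where
    z : Fin n
    z = fromℕ< (ℕ.≤-trans (s≤s z≤n) n≥3)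

    unsaturated : ∃ λ i → lookup (∁ ⁅ z ⁆) i ≡ true × lookup Q i < coweight (∁ ⁅ z ⁆) (multiplicity i)
    unsaturated = park (∁ ⁅ z ⁆) (proj₁ (another n≥2 z)) z (∈∁⁅⁆ (proj₂ (another n≥2 z)))
                 (trans (lookup-∁ ⁅ z ⁆ z) (cong not (⁅⁆-true z)))

    i : Fin n
    i = proj₁ unsaturated

    Q< : lookup Q i < coweight (∁ ⁅ z ⁆) (multiplicity i)
    Q< = proj₂ (proj₂ unsaturated)

  -- The two directions of `tree-edges` are the soundness and completeness that `guide` asks for.
  φ-run : ∀ {P t} (φ : φ[ G ] P ↦ t) → let open RootedTree t using (root) renaming (Adj to Adjₜ) ; Q = φ[_]_↦_.reduced φ in
          Guided Adjₜ root (neighbours↓ root) (state ⁅ root ⁆ Q []) (burn root Q)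
  φ-run {t = t} φ = guide {r = root} (burn-run root reduced) (⁅⁆-true root) (neighbours-unique root) (neighbours-adj root) Growth.start
    (λ e∈ → Equivalence.from (tree-edges _ _) (inj₁ e∈)) (λ _ _ tab → Equivalence.to (tree-edges _ _) tab)
    where
    open RootedTree t using (root)
    open φ[_]_↦_ φ

  -- From parking functions to uprooted trees

  module FromParking {Q} (park : Parking H Q) (r : Fin n) (Qr≡0 : lookup Q r ≡ 0)
                     (r-largest : ∀ j → lookup Q j ≡ 0 → j ≤ᶠ r) where

    private
      R : Run Always Always r (neighbours↓ r) (state ⁅ r ⁆ Q []) (burn r Q)
      R = burn-run r Q

      all-burnt : ∀ x → lookup (burnt (burn r Q)) x ≡ true
      all-burnt = parking⇒all-burnt park R

      open Growth H r

      g : Grown (burnt (burn r Q)) (edges (burn r Q))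
      g = run-grown R (⁅⁆-true r) (neighbours-adj r) start

    tree : RootedTree n
    tree = spanningTree g all-burnt

    tree-φ : φ[ G ] Q ⊕ m₁ ↦ tree
    tree-φ = record
      { reduced      = Q
      ; reduced-def  = refl
      ; root-zero    = Qr≡0
      ; root-largest = r-largest
      ; all-burnt    = λ j → lookup⇒[]= j _ (all-burnt j)
      ; tree-edges   = joinedGraph-adj g
      }

    tree-adj : ∀ {i j} → RootedTree.Adj tree i j → Adj i j
    tree-adj {i} {j} ij with Equivalence.to (joinedGraph-adj g i j) ij
    ... | inj₁ e∈ = grown-adj g e∈
    ... | inj₂ e∈ = subst T (symmetric j i) (grown-adj g e∈)

    tree-U′ : IsU′ tree
    tree-U′ = uprooted , λ i j i≡1 j≡n ij → not-1n i≡1 j≡n (tree-adj ij)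
      where
      positive : ∀ {j} → r <ᶠ j → 0 < lookup Q j
      positive {j} r<j = ℕ.n≢0⇒n>0 λ Qj≡0 → ℕ.<⇒≱ r<j (r-largest j Qj≡0)

      uprooted : Uprooted tree
      uprooted j rj with Fin.<-cmp j r
      ... | tri< j<r _ _  = j<r
      ... | tri≈ _ refl _ = contradiction (tree-adj rj) (adj-irrefl H {r})
      -- By the choice of `r` all larger values are positive, so the root dampens its edge to `j`,
      -- which then is no tree edge.
      ... | tri> _ _ r<j  = contradiction rj
        (larger-dampened (φ-run tree-φ) (⁅⁆-≡ r) (decreasing r) (λ _ → positive) (∈neighbours {r} (tree-adj rj)) r<j)

  φ-exists : ∀ {Q} → Parking H Q → ∃ λ t → IsU′ t × φ[ G ] Q ⊕ m₁ ↦ t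
  φ-exists {Q} park with r , Qr≡0 , r-largest ← largest (λ i → lookup Q i ℕ.≟ 0) (parking-zero {Q} park) =
    let open FromParking {Q} park r Qr≡0 r-largest in tree , tree-U′ , tree-φ

  ⊕-cancelʳ : ∀ (d : Vec ℕ n) {e f} → e ⊕ d ≡ f ⊕ d → e ≡ f
  ⊕-cancelʳ d {e} {f} eq = ⊕-cancelˡ d (trans (zipWith-comm ℕ.+-comm d e) (trans eq (zipWith-comm ℕ.+-comm f d)))

  module Trees = Setoid (rootedTrees n)

  φ-functional : ∀ {P t t′} → φ[ G ] P ↦ t → φ[ G ] P ↦ t′ → t Trees.≈ t′
  φ-functional {t = t} {t′} φ φ′ = r≡ , λ i j → T-injective
    (λ ij → Equivalence.from (φ′.tree-edges i j) (subst (λ E → Joined E i j) E≡ (Equivalence.to (φ.tree-edges i j) ij)))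
    (λ ij → Equivalence.from (φ.tree-edges i j) (subst (λ E → Joined E i j) (sym E≡) (Equivalence.to (φ′.tree-edges i j) ij)))
    where
    module φ  = φ[_]_↦_ φ
    module φ′ = φ[_]_↦_ φ′

    Q≡ : φ.reduced ≡ φ′.reduced
    Q≡ = ⊕-cancelʳ m₁ (trans φ.reduced-def (sym φ′.reduced-def))

    r≡ : RootedTree.root t ≡ RootedTree.root t′
    r≡ = Fin.≤-antisym (φ′.root-largest _ (trans (cong (λ Q → lookup Q _) (sym Q≡)) φ.root-zero))
                       (φ.root-largest _ (trans (cong (λ Q → lookup Q _) Q≡) φ′.root-zero))

    E≡ : edges (burn (RootedTree.root t) φ.reduced) ≡ edges (burn (RootedTree.root t′) φ′.reduced)
    E≡ = cong₂ (λ r Q → edges (burn r Q)) r≡ Q≡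

  φ-resp : ∀ {P t t′} → t Trees.≈ t′ → φ[ G ] P ↦ t′ → φ[ G ] P ↦ t
  φ-resp {t = t} {t′} (r≡ , adj≡) φ = record
    { reduced      = reduced
    ; reduced-def  = reduced-def
    ; root-zero    = subst (λ r → lookup reduced r ≡ 0) (sym r≡) root-zero
    ; root-largest = λ j Qj → subst (j ≤ᶠ_) (sym r≡) (root-largest j Qj)
    ; all-burnt    = λ j → subst (λ r → j ∈ₛ burnt (burn r reduced)) (sym r≡) (all-burnt j)
    ; tree-edges   = λ i j → subst₂ (λ b r → T b ⇔ Joined (edges (burn r reduced)) i j) (sym (adj≡ i j)) (sym r≡) (tree-edges i j)
    }
    where open φ[_]_↦_ φ

  -- The final vector is thus independent of P, so `guided-injective` can start from it. At the root
  -- the entry never changes, and `root-zero` supplies its value.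
  φ-final-zero : ∀ {P t} (φ : φ[ G ] P ↦ t) → value (burn (RootedTree.root t) (φ[_]_↦_.reduced φ)) ≡ replicate n 0
  φ-final-zero {t = t} φ = lookup-ext _ _ λ x → trans
    (run-final-zero (burn-run root reduced) x (λ Bx → trans (cong (lookup reduced) (⁅⁆-≡ root x Bx)) root-zero)
      ([]=⇒lookup (all-burnt x)))
    (sym (lookup-replicate x 0))
    where
    open RootedTree t using (root)
    open φ[_]_↦_ φ

  φ-injective : ∀ {P P′ t t′} → φ[ G ] P ↦ t → φ[ G ] P′ ↦ t′ → t Trees.≈ t′ → P ≡ P′
  φ-injective {t = t} φ φ′ t≈t′ = trans (sym φ.reduced-def) (trans (cong (_⊕ m₁) Q≡) φ″.reduced-def)
    where
    φ₂ = φ-resp {t = t} t≈t′ φ′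
    module φ  = φ[_]_↦_ φ
    module φ″ = φ[_]_↦_ φ₂

    Q≡ : φ.reduced ≡ φ″.reduced
    Q≡ = proj₂ (guided-injective (φ-run φ) (φ-run φ₂) refl) (trans (φ-final-zero φ) (sym (φ-final-zero φ₂)))

  -- From uprooted trees to parking functions

  module FromTree (t : RootedTree n) (t∈U′ : IsU′ t) where

    open RootedTree t using () renaming (root to r; graph to gₜ; Adj to Adjₜ; adj to adjₜ; connected to connectedₜ; acyclic to acyclicₜ; symmetric to symmetricₜ)

    uprooted : Uprooted t
    uprooted = proj₁ t∈U′

    t⇒adj : ∀ {a b} → Adjₜ a b → Adj a b
    t⇒adj {a} {b} ab = adj-intro (λ { refl → adj-irrefl gₜ ab }) (λ (a≡1 , b≡n) → proj₂ t∈U′ a b a≡1 b≡n ab)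
      (λ (a≡n , b≡1) → proj₂ t∈U′ b a b≡1 a≡n (subst T (symmetricₜ a b) ab))

    -- As n ≥ 2 and `t` is connected, the root has a child, which must be smaller than the root.
    root≢1 : label r ≢ 1
    root≢1 r≡1 with x , x≢r ← another n≥2 r with connectedₜ r x
    ... | ε      = x≢r refl
    ... | rc ◅ _ with () ← subst (_ <_) (ℕ.suc-injective r≡1) (uprooted _ rc)

    private
      C : Completion Adjₜ r (neighbours↓ r) ⁅ r ⁆ []
      C = completion (λ a b → T? (adjₜ a b)) n r (neighbours↓ r) ⁅ r ⁆ [] (ℕ.<⇒≤ (unburnt-⁅⁆ r))

      B′ : Subset n
      B′ = proj₁ C

      E′ : Edges n
      E′ = proj₁ (proj₂ C)

      values : ∃ λ Q → Guided Adjₜ r (neighbours↓ r) (state ⁅ r ⁆ Q []) (state B′ (replicate n 0) E′) ×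
                       (∀ x → lookup ⁅ r ⁆ x ≡ true → lookup Q x ≡ lookup (replicate n 0) x)
      -- The zero vector is an admissible final vector whatever `B′` is, so `Q` is available before
      -- everything is known to burn.
      values = proj₂ (proj₂ (proj₂ C)) (replicate n 0) (λ x _ → lookup-replicate x 0)

    Q : Vec ℕ n
    Q = proj₁ values

    private
      R : Guided Adjₜ r (neighbours↓ r) (state ⁅ r ⁆ Q []) (state B′ (replicate n 0) E′)
      R = proj₁ (proj₂ values)

      burn≡ : state B′ (replicate n 0) E′ ≡ burn r Q
      burn≡ = run-deterministic R (burn-run r Q)

      -- Burning spreads along the edges of `t`: `closed-here` treats edges leaving the root,
      -- `closed-new` those leaving a vertex burnt during the run.
      reached : ∀ {a x} → Star Adjₜ a x → lookup B′ a ≡ true → lookup B′ x ≡ true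
      reached ε B′a = B′a
      reached (_◅_ {i = a} {j = b} ab path) B′a = reached path (step (lookup ⁅ r ⁆ a) refl)
        where
        step : ∀ c → lookup ⁅ r ⁆ a ≡ c → lookup B′ b ≡ true
        step true eq with refl ← ⁅⁆-≡ r a eq = closed-here t⇒adj (λ ¬t → ¬t) R (∈neighbours {r} (t⇒adj ab)) ab
        step false eq = closed-new t⇒adj (λ ¬t → ¬t) R B′a eq ab

      all-burnt : ∀ x → lookup B′ x ≡ true
      all-burnt x = reached (connectedₜ r x) (run-burnt R r (⁅⁆-true r))

      open Growth H r

      g : Grown B′ E′
      g = run-grown R (⁅⁆-true r) (neighbours-adj r) start

      joined⇒t : ∀ {a b} → Joined E′ a b → Adjₜ a b
      joined⇒t (inj₁ e∈) with inj₂ ab ← run-followed R e∈ = ab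
      joined⇒t {a} {b} (inj₂ e∈) with inj₂ ba ← run-followed R e∈ = subst T (symmetricₜ b a) ba

      t⇒joined : ∀ {a b} → Adjₜ a b → Joined E′ a b
      t⇒joined = spanning-subgraph gₜ acyclicₜ joined⇒t (grown-connected g all-burnt)
        (λ a b → edge? (a , b) E′ ⊎-dec edge? (b , a) E′)

      root-zero : lookup Q r ≡ 0
      root-zero = trans (proj₂ (proj₂ values) r (⁅⁆-true r)) (lookup-replicate r 0)

      root-largest : ∀ j → lookup Q j ≡ 0 → j ≤ᶠ r
      root-largest j Qj≡0 = ℕ.≮⇒≥ λ r<j → contradiction (sym Qj≡0) (ℕ.<⇒≢
        (larger-positive R (⁅⁆-≡ r) (decreasing r) (uprooted _)
          -- `r` is not 1, and it is not n because `j` is larger; so the missing edge does not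
          -- separate them.
          (∈neighbours {r} (adj-intro (Fin.<⇒≢ r<j) (λ (r≡1 , _) → root≢1 r≡1)
            (λ (r≡n , _) → ℕ.<⇒≱ (subst (toℕ j <_) (sym r≡n) (toℕ<n j)) r<j)))
          r<j))

      root-neighbour : ∃ λ c → c ∈ neighbours↓ r × lookup Q c ≡ 0
      root-neighbour with root-child R (neighbours-unique r)
      ... | inj₂ child = child
      ... | inj₁ B′⊆⁅r⁆ with x , x≢r ← another n≥2 r = contradiction (⁅⁆-≡ r x (B′⊆⁅r⁆ x (all-burnt x))) x≢r

      zero-beside : ∀ A i y → lookup Q i ≡ 0 → lookup A y ≡ false → Adj i y → lookup Q i < coweight A (multiplicity i)
      zero-beside A i y Qi Ay iy = subst (_< coweight A (multiplicity i)) (sym Qi)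
        (ℕ.≤-trans (ℕ.≤-reflexive (sym (multiplicity-adj {i} {y} iy))) (coweight-≥ A y (multiplicity i) Ay))

    parking : Parking H Q
    parking A x y Ax Ay with lookup A r in Ar
    ... | false = all-burnt⇒parking R all-burnt A x Ax Ar
    ... | true with label r ℕ.≟ n ×-dec label y ℕ.≟ 1
    -- `Q` vanishes at `r`, so one neighbour of `r` outside `A` suffices. Since `r` is not 1, `y` is
    -- such a neighbour unless `r` is n and `y` is 1.
    ...   | no ¬n1 = r , Ar , zero-beside A r y root-zero Ay
              (adj-intro (λ { refl → t≢f Ar Ay }) (λ (r≡1 , _) → root≢1 r≡1) ¬n1)
    -- The child `c` of the root has value 0. Outside `A` it is the neighbour `r` needs; inside `A`
    -- it is itself the witness, being adjacent to the vertex 1, which is `y`.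
    ...   | yes (r≡n , y≡1) with c , c∈ , Qc ← root-neighbour with lookup A c in Ac
    ...     | false = r , Ar , zero-beside A r c root-zero Ac (All-lookup (neighbours-adj r) c∈)
    ...     | true  = c , Ac , zero-beside A c y Qc Ay
                (adj-intro (λ { refl → t≢f Ac Ay }) (λ (_ , y≡n) → ℕ.<⇒≢ n≥2 (trans (sym y≡1) y≡n)) (λ (c≡n , _) → c≢n c≡n))
      where
      c≢n : label c ≢ n
      c≢n c≡n with refl ← toℕ-injective {i = c} {r} (ℕ.suc-injective (trans c≡n (sym r≡n))) =
        adj-irrefl H {r} (All-lookup (neighbours-adj r) c∈)

    tree-φ : φ[ G ] Q ⊕ m₁ ↦ t
    tree-φ = record
      { reduced      = Q
      ; reduced-def  = refl
      ; root-zero    = root-zero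
      ; root-largest = root-largest
      ; all-burnt    = λ j → subst (λ s → j ∈ₛ burnt s) burn≡ (lookup⇒[]= j B′ (all-burnt j))
      ; tree-edges   = λ i j → subst (λ s → Adjₜ i j ⇔ Joined (edges s) i j) burn≡ (mk⇔ t⇒joined joined⇒t)
      }

  module _ {c ℓ₁ ℓ₂ : Level} (K : HeytingField c ℓ₁ ℓ₂) where

    open Spherical K G cone n≥2 using (spf⇒parking; parking⇒spf)

    abstract

      image : (P : Σ (Vec ℕ n) (IsSPF K G)) → ∃ λ t → IsU′ t × φ[ G ] proj₁ P ↦ t
      image (P , P∈sPF) with Q , refl , park ← spf⇒parking P∈sPF = φ-exists park

      preimage : ∀ t → IsU′ t → ∃ λ P → IsSPF K G P × φ[ G ] P ↦ t
      preimage t t∈U′ = let open FromTree t t∈U′ in Q ⊕ m₁ , parking⇒spf parking , tree-φ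

theorem3p5 : ∀ {c ℓ₁ ℓ₂ : Level} (K : HeytingField c ℓ₁ ℓ₂) (n : ℕ) → 3 ≤ n →
    Σ (Bijection (sPF K (K-e₁ n)) (U′ n)) λ φ →
    ∀ P → φ[ K-e₁ n ] proj₁ P ↦ proj₁ (Bijection.to φ P)
theorem3p5 K n n≥3 = record
  { to        = λ P → proj₁ (image K P) , proj₁ (proj₂ (image K P))
  ; cong      = λ {P} {P′} P≡P′ → φ-functional (subst (φ[ G ]_↦ proj₁ (image K P)) P≡P′ (φ-image P)) (φ-image P′)
  ; bijective = (λ {P} {P′} → φ-injective (φ-image P) (φ-image P′))
              , λ (t , t∈U′) → let P , P∈sPF , φ = preimage K t t∈U′ in
                  (P , P∈sPF) , λ {P′} P′≡P → φ-functional (φ-image P′) (subst (φ[ G ]_↦ t) (sym P′≡P) φ)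
  } , φ-image
  where
  open CompleteMinusEdge n n≥3

  φ-image : ∀ P → φ[ G ] proj₁ P ↦ proj₁ (image K P)
  φ-image P = proj₂ (proj₂ (image K P))
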